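{- Let $p$ be a prime number, let $i,j\in\mathbb{Z}$, and let $C^{(p;i,j)}$ be the hyperelliptic curve over $\mathbb{Q}$ defined by \[y^2=x(x^2+2^ip^{j})(x^2+2^{i+1}p^{j}).\] Then: \begin{enumerate} \item For all $p$, we have $C^{(p;0,2)}(\mathbb{Q})=\{(0,0),\infty\}$. \item If $p\equiv 3 \pmod 4$, then \[C^{(p;2,2)}(\mathbb{Q})=\begin{cases}\{(0,0),(6,\pm 216),\infty\} & (p=3),\\ \{(0,0),\infty\} & (p\neq 3).\end{cases}\] \item If $p\equiv 13 \pmod{16}$, then $C^{(p;2,1)}(\mathbb{Q})=\{(0,0),\infty\}$. \item If $p\equiv 5 \pmod{16}$, then $C^{(p;2,3)}(\mathbb{Q})=\{(0,0),\infty\}$. \end{enumerate}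
   Context: The right-hand side is a polynomial of degree $5$ in $x$, so $C^{(p;i,j)}$ is a genus-$2$ hyperelliptic curve with a single rational point at infinity, denoted $\infty$; $C^{(p;i,j)}(\mathbb{Q})$ denotes the set of rational points of (the smooth projective model of) this curve, consisting of $\infty$ and the affine rational solutions $(x,y)$. -}

module Defs where

open import Data.Nat as ℕ using (ℕ; zero; suc)
open import Data.Nat.Properties using (m^n≢0)
open import Data.Unit using (⊤)
import Data.Integer as ℤ
open import Data.Integer using (ℤ; +_; -[1+_])
open import Data.Rational using (ℚ; _/_; _+_; _*_; 0ℚ)
open import Relation.Binary.PropositionalEquality using (_≡_)

-- b ^ k as a rational number, for a natural base b and an integer exponent k.
-- (For b = 0 and k < 0 the value is a junk 0; it is never used, since the
-- bases occurring below are 2 and a prime p.)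
powℤ : ℕ → ℤ → ℚ
powℤ b (+ n) = (+ (b ℕ.^ n)) / 1
powℤ zero -[1+ n ] = 0ℚ
powℤ (suc k) -[1+ n ] = _/_ (+ 1) (suc k ℕ.^ suc n) {{m^n≢0 (suc k) (suc n)}}

coef : ℕ → ℤ → ℤ → ℚ
coef p i j = powℤ 2 i * powℤ p j

-- points of the smooth projective model of the genus-2 curve
-- C^(p;i,j) : y^2 = x (x^2 + 2^i p^j) (x^2 + 2^(i+1) p^j):
-- the affine points (x , y) and the single point at infinity.
data Point : Set where
  ∞ : Point
  aff : ℚ → ℚ → Point

OnCurve : ℕ → ℤ → ℤ → Point → Set
OnCurve p i j ∞ = ⊤
OnCurve p i j (aff x y) =
  y * y ≡ x * (x * x + coef p i j) * (x * x + coef p (i ℤ.+ + 1) j)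

{-# OPTIONS --safe #-}
-- Write x = m / n in lowest terms.  Then n = t² and m (m² + a t⁴)(m² + 2a t⁴) is a square, where
-- a = 2^i p^j.  Up to powers of 2 and p the three factors are coprime, so each of them is a square
-- times a divisor of 2p.  Every resulting system is excluded by a congruence modulo 16, by -1, 2
-- or -2 being a nonresidue modulo p, or by infinite descent for one of
--   three squares in arithmetic progression with difference k², 2k² or, for p ≡ 5 (mod 8), 2pk²;
--   s⁴ + 2t⁴ = z²;   s⁴ + 4qt⁴ = z² with q = p or p³ and q ≡ 13 (mod 16).
-- The only survivor is s⁴ + t⁴ = 2z² with s = t = 1, which forces p = 3 and m = 6.
module Submission where

open import Data.Bool using (Bool; true; false; T; _∧_; _∨_; not)
open import Data.Bool.Properties using (T-∨)
open import Data.Empty using (⊥; ⊥-elim)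
open import Data.Fin using (Fin; zero; suc)
open import Data.List using (List; []; _∷_; _++_)
open import Data.List.Relation.Unary.All using (All; []; _∷_)
open import Data.Nat as ℕ hiding (_/_)
open import Data.Nat.Coprimality using (Coprime; coprime-divisor; coprime-Bézout) renaming (sym to coprime-sym)
open import Data.Nat.Divisibility
open import Data.Nat.DivMod hiding (_/_)
open import Data.Nat.GCD
open import Data.Nat.Induction using (<-rec)
open import Data.Nat.Primality using (Prime; prime?; prime[2]; prime⇒irreducible; prime⇒nonZero; prime⇒nonTrivial; euclidsLemma)
open import Data.Nat.Properties
open import Data.Nat.Tactic.RingSolver using (solve-∀)
open import Data.Product using (∃; ∃₂; _×_; _,_; proj₁; proj₂)
open import Data.Sum using (_⊎_; inj₁; inj₂; [_,_]′; map₁; map₂; reduce)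
open import Data.Vec using (Vec; []; _∷_; lookup; map)
open import Data.Vec.Properties using (lookup-map)
open import Function using (_∘_; case_of_; id)
open import Function.Bundles using (_⇔_; mk⇔; Equivalence)
open import Relation.Binary.PropositionalEquality
open import Relation.Nullary using (¬_; yes; no; contradiction)
open import Relation.Nullary.Decidable using (from-yes)

-- Refuting systems of congruences by exhausting the residues

-- The argument lives in ℕ. Both quadratic factors are positive, so a rational point has x ≥ 0, and
-- each difference that occurs is introduced as a summand: b = a + 2z in place of z = (b - a) / 2.
-- Factorisation enters only through gcds: coprime factors of a square are squares, and a prime
-- power that divides a product of coprime numbers divides one of them. Excluding three squares with
-- difference D k² means that D is not a congruent number; this is used for D = 1, 2 and 2p with p ≡
-- 5 (mod 8). The statements on -1, 2 and -2 are proved for every modulus in a residue class,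
-- composite ones included, because the descent on the modulus passes to a cofactor that need not be
-- prime. The quartic s⁴ + 4qt⁴ = z² is what dictates the classes modulo 16: its descent branches
-- off into twisted equations, and these are closed by q ≡ 13 (mod 16). For exponent 1 this is p ≡
-- 13; for exponent 3 it is p ≡ 5, as 5³ = 125 ≡ 13.

infixl 6 _⊕_
infixl 7 _⊗_

data Poly (n : ℕ) : Set where
  var : Fin n → Poly n
  con : ℕ → Poly n
  _⊕_ _⊗_ : Poly n → Poly n → Poly n

⟦_⟧ : ∀ {n} → Poly n → Vec ℕ n → ℕ
⟦ var i ⟧ ρ = lookup ρ i
⟦ con c ⟧ ρ = c
⟦ e ⊕ f ⟧ ρ = ⟦ e ⟧ ρ + ⟦ f ⟧ ρ
⟦ e ⊗ f ⟧ ρ = ⟦ e ⟧ ρ * ⟦ f ⟧ ρ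

⟦⟧-% : ∀ {n} M .{{_ : NonZero M}} (e : Poly n) ρ → ⟦ e ⟧ ρ % M ≡ ⟦ e ⟧ (map (_% M) ρ) % M
⟦⟧-% M (var i) ρ = trans (sym (m%n%n≡m%n (lookup ρ i) M)) (cong (_% M) (sym (lookup-map i (_% M) ρ)))
⟦⟧-% M (con c) ρ = refl
⟦⟧-% M (e ⊕ f) ρ = begin
  (⟦ e ⟧ ρ + ⟦ f ⟧ ρ) % M                         ≡⟨ %-distribˡ-+ (⟦ e ⟧ ρ) (⟦ f ⟧ ρ) M ⟩
  (⟦ e ⟧ ρ % M + ⟦ f ⟧ ρ % M) % M                 ≡⟨ cong₂ (λ x y → (x + y) % M) (⟦⟧-% M e ρ) (⟦⟧-% M f ρ) ⟩
  (⟦ e ⟧ ρ′ % M + ⟦ f ⟧ ρ′ % M) % M               ≡⟨ %-distribˡ-+ (⟦ e ⟧ ρ′) (⟦ f ⟧ ρ′) M ⟨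
  (⟦ e ⟧ ρ′ + ⟦ f ⟧ ρ′) % M                       ∎
  where open ≡-Reasoning
        ρ′ = map (_% M) ρ
⟦⟧-% M (e ⊗ f) ρ = begin
  (⟦ e ⟧ ρ * ⟦ f ⟧ ρ) % M                         ≡⟨ %-distribˡ-* (⟦ e ⟧ ρ) (⟦ f ⟧ ρ) M ⟩
  (⟦ e ⟧ ρ % M * (⟦ f ⟧ ρ % M)) % M               ≡⟨ cong₂ (λ x y → (x * y) % M) (⟦⟧-% M e ρ) (⟦⟧-% M f ρ) ⟩
  (⟦ e ⟧ ρ′ % M * (⟦ f ⟧ ρ′ % M)) % M             ≡⟨ %-distribˡ-* (⟦ e ⟧ ρ′) (⟦ f ⟧ ρ′) M ⟨
  (⟦ e ⟧ ρ′ * ⟦ f ⟧ ρ′) % M                       ∎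
  where open ≡-Reasoning
        ρ′ = map (_% M) ρ

System : ℕ → Set
System n = List (Poly n × Poly n)

Congruent : ∀ {n} M .{{_ : NonZero M}} → System n → Vec ℕ n → Set
Congruent M s ρ = All (λ (e , f) → ⟦ e ⟧ ρ % M ≡ ⟦ f ⟧ ρ % M) s

fails : ∀ {n} M .{{_ : NonZero M}} → System n → Vec ℕ n → Bool
fails M []            ρ = false
fails M ((e , f) ∷ s) ρ = not ((⟦ e ⟧ ρ % M) ≡ᵇ (⟦ f ⟧ ρ % M)) ∨ fails M s ρ

all< : ℕ → (ℕ → Bool) → Bool
all< zero    P = true
all< (suc m) P = P m ∧ all< m P

allResidues : ℕ → ∀ n → (Vec ℕ n → Bool) → Bool
allResidues M zero    P = P []
allResidues M (suc n) P = all< M λ r → allResidues M n λ ρ → P (r ∷ ρ)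

∧-T : ∀ {a b} → T (a ∧ b) → T a × T b
∧-T {true} {true} _ = _ , _

all<-sound : ∀ m P → T (all< m P) → ∀ {r} → r < m → T (P r)
all<-sound (suc m) P ok {r} (s≤s r≤m) with m≤n⇒m<n∨m≡n r≤m
... | inj₁ r<m  = all<-sound m P (proj₂ (∧-T {P m} ok)) r<m
... | inj₂ refl = proj₁ (∧-T {P m} ok)

allResidues-sound : ∀ M .{{_ : NonZero M}} n P → T (allResidues M n P) → ∀ ρ → T (P (map (_% M) ρ))
allResidues-sound M zero    P ok []      = ok
allResidues-sound M (suc n) P ok (x ∷ ρ) =
  allResidues-sound M n _ (all<-sound M _ ok (m%n<n x M)) ρ

fails-sound : ∀ {n} M .{{_ : NonZero M}} (s : System n) ρ → T (fails M s (map (_% M) ρ)) → ¬ Congruent M s ρ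
fails-sound M ((e , f) ∷ s) ρ failed (eq ∷ eqs)
  with ⟦ e ⟧ (map (_% M) ρ) % M ≡ᵇ ⟦ f ⟧ (map (_% M) ρ) % M in same
... | true  = fails-sound M s ρ failed eqs
... | false = subst T same (≡⇒≡ᵇ _ _ (trans (sym (⟦⟧-% M e ρ)) (trans eq (⟦⟧-% M f ρ))))

-- The argument of type `T` is discharged by evaluation: the search over all residue vectors
-- computes to `true`, so `_` fills it at each use.
consequence : ∀ {n} M .{{_ : NonZero M}} (s : System n) (Q : Vec ℕ n → Bool) →
              T (allResidues M n (λ ρ → fails M s ρ ∨ Q ρ)) →
              ∀ ρ → Congruent M s ρ → T (Q (map (_% M) ρ))
consequence M s Q ok ρ holds
  with fails M s (map (_% M) ρ) in eq | allResidues-sound M _ (λ ρ → fails M s ρ ∨ Q ρ) ok ρ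
... | true  | _ = ⊥-elim (fails-sound M s ρ (subst T (sym eq) _) holds)
... | false | q = q

insoluble : ∀ {n} M .{{_ : NonZero M}} (s : System n) →
            T (allResidues M n (λ ρ → fails M s ρ ∨ false)) → ∀ ρ → ¬ Congruent M s ρ
insoluble M s = consequence M s (λ _ → false)

-- A coefficient known only by its class is replaced by its residue, so that it enters the residue
-- search as a constant instead of one more variable.
%-coefficient : ∀ M q {r} .{{_ : NonZero M}} → q % M ≡ r → ∀ x y → (x + q * y) % M ≡ (x + r * y) % M
%-coefficient M q {r} q%M≡r x y = trans (cong (_% M) (trans
  (cong (λ w → x + w * y) (trans (m≡m%n+[m/n]*n q M) (cong (_+ q ℕ./ M * M) q%M≡r)))
  (regroup x y (q ℕ./ M) M r))) ([m+kn]%n≡m%n (x + r * y) (q ℕ./ M * y) M)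
  where regroup : ∀ x y j M r → x + (r + j * M) * y ≡ x + r * y + j * y * M
        regroup = solve-∀

pattern v₀ = var zero
pattern v₁ = var (suc zero)
pattern v₂ = var (suc (suc zero))
pattern v₃ = var (suc (suc (suc zero)))
pattern v₄ = var (suc (suc (suc (suc zero))))

-- Bracketed like `x * x * (x * x)` in the statements, so that evaluating the polynomial yields
-- exactly their terms.
fourth : ∀ {n} → Poly n → Poly n
fourth e = e ⊗ e ⊗ (e ⊗ e)

odd : ∀ {n} → Fin n → Poly n
odd i = con 1 ⊕ con 2 ⊗ var i

-- Parity

Even Odd : ℕ → Set
Even n = ∃ λ k → n ≡ 2 * k
Odd n = ∃ λ k → n ≡ 1 + 2 * k

opaque
  even-or-odd : ∀ n → Even n ⊎ Odd n
  even-or-odd zero = inj₁ (0 , refl)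
  even-or-odd (suc n) with even-or-odd n
  ... | inj₁ (k , refl) = inj₂ (k , refl)
  ... | inj₂ (k , refl) = inj₁ (suc k , shift k)
    where shift : ∀ k → suc (1 + 2 * k) ≡ 2 * suc k
          shift = solve-∀

even×odd⇒⊥ : ∀ {n} → Even n → Odd n → ⊥
even×odd⇒⊥ (k , refl) (j , eq) =
  insoluble 2 ((con 2 ⊗ v₀ , con 1 ⊕ con 2 ⊗ v₁) ∷ []) _ (k ∷ j ∷ []) (cong (_% 2) eq ∷ [])

Odd-* : ∀ {a b} → Odd a → Odd b → Odd (a * b)
Odd-* (j , refl) (k , refl) = j + k + 2 * j * k , expand j k
  where expand : ∀ j k → (1 + 2 * j) * (1 + 2 * k) ≡ 1 + 2 * (j + k + 2 * j * k)
        expand = solve-∀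

Odd-*⁻ˡ : ∀ a b → Odd (a * b) → Odd a
Odd-*⁻ˡ a b ab-odd with even-or-odd a
... | inj₂ a-odd      = a-odd
... | inj₁ (k , refl) = ⊥-elim (even×odd⇒⊥ (k * b , *-assoc 2 k b) ab-odd)

Odd-+⇒Even : ∀ {a b} → Odd a → Odd b → Even (a + b)
Odd-+⇒Even (j , refl) (k , refl) = 1 + j + k , expand j k
  where expand : ∀ j k → 1 + 2 * j + (1 + 2 * k) ≡ 2 * (1 + j + k)
        expand = solve-∀

-- Coprimality

coprime-∣ : ∀ {a a′ b b′} → a′ ∣ a → b′ ∣ b → Coprime a b → Coprime a′ b′
coprime-∣ a′∣a b′∣b c (d∣a′ , d∣b′) = c (∣-trans d∣a′ a′∣a , ∣-trans d∣b′ b′∣b)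

coprime-∣ˡ : ∀ {a a′ b} → a′ ∣ a → Coprime a b → Coprime a′ b
coprime-∣ˡ a′∣a = coprime-∣ a′∣a ∣-refl

coprime-∣ʳ : ∀ {a b b′} → b′ ∣ b → Coprime a b → Coprime a b′
coprime-∣ʳ = coprime-∣ ∣-refl

coprime-*ʳ : ∀ {a b c} → Coprime a b → Coprime a c → Coprime a (b * c)
coprime-*ʳ a⊥b a⊥c (d∣a , d∣bc) = a⊥c (d∣a , coprime-divisor (coprime-∣ˡ d∣a a⊥b) d∣bc)

coprime-*ˡ : ∀ {a b c} → Coprime a c → Coprime b c → Coprime (a * b) c
coprime-*ˡ a⊥c b⊥c = coprime-sym (coprime-*ʳ (coprime-sym a⊥c) (coprime-sym b⊥c))

coprime-² : ∀ {a b} → Coprime a b → Coprime (a * a) (b * b)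
coprime-² a⊥b = coprime-*ˡ (coprime-*ʳ a⊥b a⊥b) (coprime-*ʳ a⊥b a⊥b)

coprime-²ˡ : ∀ {a b} → Coprime a b → Coprime (a * a) b
coprime-²ˡ a⊥b = coprime-*ˡ a⊥b a⊥b

coprime-²ʳ : ∀ {a b} → Coprime a b → Coprime a (b * b)
coprime-²ʳ a⊥b = coprime-*ʳ a⊥b a⊥b

coprime-+ˡ : ∀ {a b c} → a ∣ c → Coprime a b → Coprime a (c + b)
coprime-+ˡ a∣c a⊥b (d∣a , d∣c+b) = a⊥b (d∣a , ∣m+n∣m⇒∣n d∣c+b (∣-trans d∣a a∣c))

coprime-+ʳ : ∀ {a b c} → a ∣ c → Coprime a b → Coprime a (b + c)
coprime-+ʳ {a} {b} {c} a∣c a⊥b = subst (Coprime a) (+-comm c b) (coprime-+ˡ a∣c a⊥b)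

coprime-1ˡ : ∀ {n} → Coprime 1 n
coprime-1ˡ (d∣1 , _) = ∣1⇒≡1 d∣1

coprime-self : ∀ {a} → Coprime a a → a ≡ 1
coprime-self c = c (∣-refl , ∣-refl)

prime-coprime-or-∣ : ∀ {p} → Prime p → ∀ n → Coprime p n ⊎ p ∣ n
prime-coprime-or-∣ {p} pp n with p ∣? n
... | yes p∣n = inj₂ p∣n
... | no  p∤n = inj₁ λ (d∣p , d∣n) → case prime⇒irreducible pp d∣p of λ where
  (inj₁ d≡1)  → d≡1
  (inj₂ refl) → contradiction d∣n p∤n

prime∤1 : ∀ {p} → Prime p → ¬ p ∣ 1
prime∤1 pp p∣1 = nonTrivial⇒≢1 {{prime⇒nonTrivial pp}} (∣1⇒≡1 p∣1)

prime-∣² : ∀ {p n} → Prime p → p ∣ n * n → p ∣ n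
prime-∣² pp p∣n² = reduce (euclidsLemma _ _ pp p∣n²)

coprime-odd : ∀ {n} → Odd n → Coprime 2 n
coprime-odd n-odd with prime-coprime-or-∣ prime[2] _
... | inj₁ 2⊥n             = 2⊥n
... | inj₂ (divides k eq) = ⊥-elim (even×odd⇒⊥ (k , trans eq (*-comm k 2)) n-odd)

odd-coprime : ∀ {n} → Coprime 2 n → Odd n
odd-coprime {n} 2⊥n with even-or-odd n
... | inj₂ n-odd    = n-odd
... | inj₁ (k , refl) = case 2⊥n (∣-refl , m∣m*n k) of λ ()

coprime-even⇒odd : ∀ {m n} → Even m → Coprime m n → Odd n
coprime-even⇒odd (k , refl) m⊥n = odd-coprime (coprime-∣ˡ (m∣m*n k) m⊥n)

opaque
  coprime-ratio : ∀ a b .{{_ : NonZero b}} → ∃₂ λ a′ b′ → Coprime a′ b′ × a ≡ a′ * gcd a b × b ≡ b′ * gcd a b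
  coprime-ratio a b with gcd a b | gcd-GCD a b | gcd[m,n]≢0 a b (inj₂ (≢-nonZero⁻¹ b))
  ... | g | isGCD | g≢0 with GCD.gcd∣m isGCD | GCD.gcd∣n isGCD
  ... | divides a′ a≡ | divides b′ b≡ = a′ , b′ , a′⊥b′ , a≡ , b≡
    where
    instance
      nonZero-g : NonZero g
      nonZero-g = ≢-nonZero g≢0
    scale : ∀ {d x y} → x ≡ y * g → d ∣ y → d * g ∣ x
    scale refl d∣y = *-monoˡ-∣ g d∣y
    a′⊥b′ : Coprime a′ b′
    a′⊥b′ {d} (d∣a′ , d∣b′) = ∣1⇒≡1 (*-cancelʳ-∣ g
      (subst (d * g ∣_) (sym (*-identityˡ g)) (GCD.greatest isGCD (scale a≡ d∣a′ , scale b≡ d∣b′))))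

-- Squares

IsSquare : ℕ → Set
IsSquare n = ∃ λ r → n ≡ r * r

opaque
  -- After dividing g and c by their gcd, g′² ∣ c′² with g′ prime to c′, so g′ = 1.
  root-∣ : ∀ {g c} → g * g ∣ c * c → g ∣ c
  root-∣ {g} {zero}  _ = g ∣0
  root-∣ {g} {suc c} g²∣c² with coprime-ratio g (suc c)
  ... | g′ , c′ , g′⊥c′ , g≡ , c≡ = subst (_∣ suc c) (sym g≡d) (gcd[m,n]∣n g (suc c))
    where
    d : ℕ
    d = gcd g (suc c)
    instance
      nonZero-d : NonZero d
      nonZero-d = ≢-nonZero (gcd[m,n]≢0 g (suc c) (inj₂ λ ()))
      nonZero-d² : NonZero (d * d)
      nonZero-d² = m*n≢0 d d
    square : ∀ x y → (x * y) * (x * y) ≡ x * x * (y * y)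
    square = solve-∀
    g′²∣c′² : g′ * g′ ∣ c′ * c′
    g′²∣c′² = *-cancelʳ-∣ (d * d) (subst₂ _∣_
      (trans (cong₂ _*_ g≡ g≡) (square g′ d)) (trans (cong₂ _*_ c≡ c≡) (square c′ d)) g²∣c²)
    g′≡1 : g′ ≡ 1
    g′≡1 = coprime-²ʳ g′⊥c′ (∣-refl , m*n∣⇒m∣ g′ g′ g′²∣c′²)
    g≡d : g ≡ d
    g≡d = trans g≡ (trans (cong (_* d) g′≡1) (*-identityˡ d))

opaque
  sq-injective : ∀ {a b} → a * a ≡ b * b → a ≡ b
  sq-injective eq = ∣-antisym (root-∣ (∣-reflexive eq)) (root-∣ (∣-reflexive (sym eq)))

opaque
  sq≡0 : ∀ {a} → a * a ≡ 0 → a ≡ 0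
  sq≡0 {a} = sq-injective {a} {0}

opaque
  sq-cancel-≤ : ∀ {a b} → a * a ≤ b * b → a ≤ b
  sq-cancel-≤ a²≤b² = ≮⇒≥ λ b<a → <⇒≱ (*-mono-< b<a b<a) a²≤b²

opaque
  -- Let g = gcd(a, t), a = a′ g and t = t′ g. Then a′ b = t′² g forces a′ ∣ g, and g / a′ divides
  -- both a and b, hence is 1. So a = g² and b = t′². If t = 0, one factor is 0 and coprimality
  -- makes the other 1.
  coprime-square : ∀ a b t → Coprime a b → a * b ≡ t * t →
                   ∃₂ λ u v → a ≡ u * u × b ≡ v * v × t ≡ u * v
  coprime-square a b zero a⊥b ab≡0 with m*n≡0⇒m≡0∨n≡0 a ab≡0
  ... | inj₁ refl = 0 , 1 , refl , a⊥b (b ∣0 , ∣-refl) , refl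
  ... | inj₂ refl = 1 , 0 , a⊥b (∣-refl , a ∣0) , refl , refl
  coprime-square a b t@(suc _) a⊥b ab≡t² with coprime-ratio a t
  ... | a′ , t′ , a′⊥t′ , a≡ , t≡ = g , t′ , a≡g² , b≡t′² , trans t≡ (*-comm t′ g)
    where
    g : ℕ
    g = gcd a t
    instance
      nonZero-g : NonZero g
      nonZero-g = ≢-nonZero (gcd[m,n]≢0 a t (inj₂ λ ()))
    assoc : ∀ g x b → g * (x * b) ≡ x * g * b
    assoc = solve-∀
    assoc′ : ∀ g x → x * g * (x * g) ≡ g * (x * x * g)
    assoc′ = solve-∀
    a′b≡ : a′ * b ≡ t′ * t′ * g
    a′b≡ = *-cancelˡ-≡ _ _ g (trans (assoc g a′ b)
      (trans (cong (_* b) (sym a≡)) (trans ab≡t² (trans (cong₂ _*_ t≡ t≡) (assoc′ g t′)))))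
    a′∣g : a′ ∣ g
    a′∣g = coprime-divisor (coprime-²ʳ a′⊥t′) (subst (a′ ∣_) a′b≡ (m∣m*n b))
    instance
      nonZero-a′ : NonZero a′
      nonZero-a′ = ≢-nonZero {a′} λ { refl → ≢-nonZero⁻¹ g (0∣⇒≡0 a′∣g) }
    cofactor : ∀ a′ s g′ → s * (g′ * a′) ≡ a′ * (s * g′)
    cofactor = solve-∀
    g≡a′ : g ≡ a′
    g≡a′ with a′∣g
    ... | divides g′ g≡ = trans g≡ (trans (cong (_* a′) g′≡1) (*-identityˡ a′))
      where
      b≡ : b ≡ t′ * t′ * g′
      b≡ = *-cancelˡ-≡ _ _ a′ (trans a′b≡ (trans (cong (t′ * t′ *_) g≡) (cofactor a′ (t′ * t′) g′)))
      g′≡1 : g′ ≡ 1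
      g′≡1 = a⊥b (subst (g′ ∣_) (sym a≡) (∣n⇒∣m*n a′ (subst (g′ ∣_) (sym g≡) (m∣m*n a′)))
                 , subst (g′ ∣_) (sym b≡) (n∣m*n (t′ * t′)))
    a≡g² : a ≡ g * g
    a≡g² = trans a≡ (cong (_* g) (sym g≡a′))
    b≡t′² : b ≡ t′ * t′
    b≡t′² = *-cancelˡ-≡ _ _ a′ (trans a′b≡ (trans (cong (t′ * t′ *_) g≡a′) (*-comm (t′ * t′) a′)))

opaque
  coprime-fourth : ∀ a b t → Coprime a b → a * b ≡ t * t * (t * t) →
                   ∃₂ λ u v → a ≡ u * u * (u * u) × b ≡ v * v * (v * v) × t ≡ u * v
  coprime-fourth a b t a⊥b eq with coprime-square a b (t * t) a⊥b eq
  ... | x , y , refl , refl , t²≡xy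
    with coprime-square x y t (coprime-∣ (m∣m*n x) (m∣m*n y) a⊥b) (sym t²≡xy)
  ... | u , v , refl , refl , t≡uv = u , v , refl , refl , t≡uv

opaque
  square-factorˡ : ∀ {a b} → Coprime a b → IsSquare (a * b) → IsSquare a
  square-factorˡ {a} {b} a⊥b (t , eq) with coprime-square a b t a⊥b eq
  ... | u , _ , a≡ , _ = u , a≡

opaque
  square-factorʳ : ∀ {a b} → Coprime a b → IsSquare (a * b) → IsSquare b
  square-factorʳ {a} {b} a⊥b (t , eq) with coprime-square a b t a⊥b eq
  ... | _ , v , _ , b≡ , _ = v , b≡

opaque
  square-unscale : ∀ {n} d .{{_ : NonZero d}} → IsSquare (d * d * n) → IsSquare n
  square-unscale {n} d (r , eq) with root-∣ {d} {r} (subst (d * d ∣_) eq (m∣m*n n))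
  ... | divides s refl = s , *-cancelˡ-≡ _ _ (d * d) {{m*n≢0 d d}} (trans eq (rearrange s d))
    where rearrange : ∀ s d → s * d * (s * d) ≡ d * d * (s * s)
          rearrange = solve-∀

-- Holds for 1 and the prime powers.
Primary : ℕ → Set
Primary q = ∀ {a b} → Coprime a b → Coprime q a ⊎ Coprime q b

opaque
  prime[3] : Prime 3
  prime[3] = from-yes (prime? 3)

opaque
  primary-1 : Primary 1
  primary-1 _ = inj₁ coprime-1ˡ

opaque
  primary-prime : ∀ {p} → Prime p → Primary p
  primary-prime pp {a} {b} a⊥b with prime-coprime-or-∣ pp a | prime-coprime-or-∣ pp b
  ... | inj₁ p⊥a | _        = inj₁ p⊥a
  ... | _        | inj₁ p⊥b = inj₂ p⊥b
  ... | inj₂ p∣a | inj₂ p∣b = contradiction (∣-reflexive (a⊥b (p∣a , p∣b))) (prime∤1 pp)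

opaque
  primary-cube : ∀ {q} → Primary q → Primary (q * (q * q))
  primary-cube prim a⊥b with prim a⊥b
  ... | inj₁ q⊥a = inj₁ (coprime-*ˡ q⊥a (coprime-²ˡ q⊥a))
  ... | inj₂ q⊥b = inj₂ (coprime-*ˡ q⊥b (coprime-²ˡ q⊥b))

opaque
  primary-² : ∀ {q} → Primary q → Primary (q * q)
  primary-² prim a⊥b with prim a⊥b
  ... | inj₁ q⊥a = inj₁ (coprime-²ˡ q⊥a)
  ... | inj₂ q⊥b = inj₂ (coprime-²ˡ q⊥b)

opaque
  -- Being prime to one of the two factors, q divides the other as a whole.
  primary-split : ∀ {q} .{{_ : NonZero q}} → Primary q → ∀ a b c → Coprime a b → a * b ≡ q * c →
                  (∃ λ a′ → a ≡ q * a′ × a′ * b ≡ c) ⊎ (∃ λ b′ → b ≡ q * b′ × a * b′ ≡ c)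
  primary-split {q} prim a b c a⊥b eq with prim a⊥b
  ... | inj₁ q⊥a with coprime-divisor q⊥a (subst (q ∣_) (sym eq) (m∣m*n c))
  ...   | divides b′ refl = inj₂ (b′ , *-comm b′ q , *-cancelˡ-≡ _ _ q (trans (swap q a b′) eq))
    where swap : ∀ q a b → q * (a * b) ≡ a * (b * q)
          swap = solve-∀
  primary-split {q} prim a b c a⊥b eq | inj₂ q⊥b
    with coprime-divisor q⊥b (subst (q ∣_) (trans (sym eq) (*-comm a b)) (m∣m*n c))
  ...   | divides a′ refl = inj₁ (a′ , *-comm a′ q , *-cancelˡ-≡ _ _ q (trans (swap q a′ b) eq))
    where swap : ∀ q a b → q * (a * b) ≡ a * q * b
          swap = solve-∀

opaque
  primary-square : ∀ {q} .{{_ : NonZero q}} → Primary q → ∀ a b t → Coprime a b → a * b ≡ q * (t * t) →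
    (∃₂ λ u v → a ≡ q * (u * u) × b ≡ v * v × t ≡ u * v) ⊎ (∃₂ λ u v → a ≡ u * u × b ≡ q * (v * v) × t ≡ u * v)
  primary-square {q} prim a b t a⊥b eq with primary-split prim a b (t * t) a⊥b eq
  ... | inj₁ (a′ , refl , eq′) =
    let u , v , a′≡ , b≡ , t≡ = coprime-square a′ b t (coprime-∣ˡ (n∣m*n q) a⊥b) eq′
    in inj₁ (u , v , cong (q *_) a′≡ , b≡ , t≡)
  ... | inj₂ (b′ , refl , eq′) =
    let u , v , a≡ , b′≡ , t≡ = coprime-square a b′ t (coprime-∣ʳ (n∣m*n q) a⊥b) eq′
    in inj₂ (u , v , a≡ , cong (q *_) b′≡ , t≡)

opaque
  primary-fourth : ∀ {q} .{{_ : NonZero q}} → Primary q → ∀ a b t → Coprime a b → a * b ≡ q * (t * t * (t * t)) →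
    (∃₂ λ u v → a ≡ q * (u * u * (u * u)) × b ≡ v * v * (v * v) × t ≡ u * v) ⊎
    (∃₂ λ u v → a ≡ u * u * (u * u) × b ≡ q * (v * v * (v * v)) × t ≡ u * v)
  primary-fourth {q} prim a b t a⊥b eq with primary-split prim a b (t * t * (t * t)) a⊥b eq
  ... | inj₁ (a′ , refl , eq′) =
    let u , v , a′≡ , b≡ , t≡ = coprime-fourth a′ b t (coprime-∣ˡ (n∣m*n q) a⊥b) eq′
    in inj₁ (u , v , cong (q *_) a′≡ , b≡ , t≡)
  ... | inj₂ (b′ , refl , eq′) =
    let u , v , a≡ , b′≡ , t≡ = coprime-fourth a b′ t (coprime-∣ʳ (n∣m*n q) a⊥b) eq′
    in inj₂ (u , v , a≡ , cong (q *_) b′≡ , t≡)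

opaque
  -- This is y = ((b - a) / 2) ((b + a) / 2) with z = (b - a) / 2, an integer because b² = a² + 4y
  -- is odd. The descents on Diophantine equations all enter through it.
  square-gap : ∀ {a b} y → Odd a → b * b ≡ a * a + 4 * y → ∃ λ z → b ≡ z + (z + a) × z * (z + a) ≡ y
  square-gap {a} {b} y a-odd eq with m≤n⇒∃[o]m+o≡n (sq-cancel-≤ {a} {b} (subst (a * a ≤_) (sym eq) (m≤m+n _ _)))
  ... | e , refl with even-or-odd e
  ... | inj₁ (z , refl) = z , twice a z , *-cancelˡ-≡ _ _ 4 (+-cancelˡ-≡ (a * a) _ _ (trans (expand a z) eq))
    where
    twice : ∀ a z → a + 2 * z ≡ z + (z + a)
    twice = solve-∀
    expand : ∀ a z → a * a + 4 * (z * (z + a)) ≡ (a + 2 * z) * (a + 2 * z)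
    expand = solve-∀
  ... | inj₂ (z , refl) with a-odd
  ... | k , refl = ⊥-elim (insoluble 2
    (( (con 1 ⊕ con 2 ⊗ v₀ ⊕ (con 1 ⊕ con 2 ⊗ v₁)) ⊗ (con 1 ⊕ con 2 ⊗ v₀ ⊕ (con 1 ⊕ con 2 ⊗ v₁))
     , (con 1 ⊕ con 2 ⊗ v₀) ⊗ (con 1 ⊕ con 2 ⊗ v₀) ⊕ con 4 ⊗ v₂) ∷ []) _ (k ∷ z ∷ y ∷ [])
    (cong (_% 2) eq ∷ []))

-- Nonresidues

-- Modulo n, s is -r and has the same square.
∣-reflect : ∀ {n r s} c → r + s ≡ n → n ∣ r * r + c → n ∣ s * s + c
∣-reflect {r = r} {s} c refl n∣ = ∣m+n∣m⇒∣n
  (subst (r + s ∣_) (expand r s c) (∣m∣n⇒∣m+n n∣ (m∣m*n (2 * s)))) (m∣m*n (r + s))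
  where expand : ∀ r s c → r * r + c + (r + s) * (2 * s) ≡ (r + s) * (r + s) + (s * s + c)
        expand = solve-∀

∣-residue : ∀ {n} x {c} .{{_ : NonZero n}} → n ∣ x * x + c → n ∣ (x % n) * (x % n) + c
∣-residue {n} x {c} n∣ = ∣m+n∣m⇒∣n
  (subst (n ∣_) (trans (cong (λ y → y * y + c) (m≡m%n+[m/n]*n x n)) (expand (x % n) (x ℕ./ n) n c)) n∣)
  (m∣m*n _)
  where expand : ∀ r q n c → (r + q * n) * (r + q * n) + c ≡ n * (2 * q * r + q * q * n) + (r * r + c)
        expand = solve-∀

opaque
  -- The roots r and n - r lie below the odd n and have opposite parity; n ∤ c keeps the residue 0
  -- away. Choosing the parity fixes the class of the cofactor in the descents that follow.
  root-of-each-parity : ∀ {n} x c → Odd n → ¬ n ∣ c → n ∣ x * x + c →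
    ∃₂ λ r s → r < n × s < n × Odd r × Even s × n ∣ r * r + c × n ∣ s * s + c
  root-of-each-parity {n} x c n-odd@(k , refl) n∤c n∣ with m≤n⇒∃[o]m+o≡n (<⇒≤ (m%n<n x n))
  ... | s , r+s≡n with x % n | m%n<n x n | ∣-residue x n∣
  ...   | zero  | _   | n∣c = contradiction n∣c n∤c
  ...   | suc r | r<n | n∣r with even-or-odd (suc r) | even-or-odd s
  ...     | inj₂ r-odd  | inj₁ s-even = _ , _ , r<n , s<n , r-odd , s-even , n∣r , ∣-reflect {r = suc r} {s} c r+s≡n n∣r
    where s<n : s < n
          s<n = subst (s <_) r+s≡n (m<n+m s z<s)
  ...     | inj₁ r-even | inj₂ s-odd  = _ , _ , s<n , r<n , s-odd , r-even , ∣-reflect {r = suc r} {s} c r+s≡n n∣r , n∣r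
    where s<n : s < n
          s<n = subst (s <_) r+s≡n (m<n+m s z<s)
  ...     | inj₁ (i , r≡) | inj₁ (j , refl) = ⊥-elim (even×odd⇒⊥ (i + j , trans (sym r+s≡n)
              (trans (cong (_+ 2 * j) r≡) (sym (*-distribˡ-+ 2 i j)))) n-odd)
  ...     | inj₂ (i , r≡) | inj₂ (j , refl) = ⊥-elim (even×odd⇒⊥ (1 + i + j , trans (sym r+s≡n)
              (trans (cong (_+ (1 + 2 * j)) r≡) (add i j))) n-odd)
    where add : ∀ i j → 1 + 2 * i + (1 + 2 * j) ≡ 2 * (1 + i + j)
          add = solve-∀

odd-if : ∀ {n} → n % 2 ≡ 1 → Odd n
odd-if {n} n%2≡1 = n ℕ./ 2 , trans (m≡m%n+[m/n]*n n 2) (cong₂ _+_ n%2≡1 (*-comm (n ℕ./ 2) 2))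

reduce-% : ∀ n d {M r} .{{_ : NonZero d}} .{{_ : NonZero M}} → d ∣ M → n % M ≡ r → n % d ≡ r % d
reduce-% n d {M} d∣M n%M≡r = trans (sym (m∣n⇒o%n%m≡o%m d M n d∣M)) (cong (_% d) n%M≡r)

-- In each descent the cofactor of n in the value at a root below n is a smaller modulus of the same kind.

opaque
  2-nonresidue : ∀ n c → n % 8 ≡ 3 ⊎ n % 8 ≡ 5 → n ≡ 2 + c → ∀ x → ¬ n ∣ x * x + c
  2-nonresidue = <-rec _ λ n rec c n%8 n≡2+c x n∣ →
    let r , _ , r<n , _ , r-odd , _ , n∣r , _ = root-of-each-parity x c (n-odd n n%8) (n∤c n%8 n≡2+c) n∣
        k , eq = cofactor r-odd n≡2+c n∣r
        k%8 = class n k r n%8 r-odd eq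
        c′ , k≡2+c′ = big k k%8
    -- With k = 2 + c′, the equation r² = 2 + n k gives r² + c′ = (n + 1) k.
    in rec (smaller r<n eq) c′ k%8 k≡2+c′ r
         (divides (suc n) (trans (cong (_+ c′) eq) (trans (rearrange n k c′) (cong (_+ n * k) (sym k≡2+c′)))))
    where
    rearrange : ∀ n k c → 2 + n * k + c ≡ 2 + c + n * k
    rearrange = solve-∀
    n-odd : ∀ n → n % 8 ≡ 3 ⊎ n % 8 ≡ 5 → Odd n
    n-odd n = [ odd-if ∘ reduce-% n 2 (divides 4 refl) , odd-if ∘ reduce-% n 2 (divides 4 refl) ]′
    n∤c : ∀ {n c} → n % 8 ≡ 3 ⊎ n % 8 ≡ 5 → n ≡ 2 + c → ¬ n ∣ c
    n∤c {c = zero}  (inj₁ ()) refl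
    n∤c {c = zero}  (inj₂ ()) refl
    n∤c {c = suc c} _ refl n∣c = <⇒≱ (m<n+m (suc c) {2} z<s) (∣⇒≤ n∣c)
    -- As c = n - 2 is -2 modulo n, a multiple r² + c = (q + 1) n says r² = 2 + n q; the multiple 0
    -- is excluded because r is odd.
    cofactor : ∀ {n c r} → Odd r → n ≡ 2 + c → n ∣ r * r + c → ∃ λ k → r * r ≡ 2 + n * k
    cofactor {c = c} (j , refl) refl (divides zero ())
    cofactor {c = c} {r} _ refl (divides (suc q) eq) = q , +-cancelʳ-≡ c _ _ (trans eq (add c q))
      where add : ∀ c q → 2 + c + q * (2 + c) ≡ 2 + (2 + c) * q + c
            add = solve-∀
    -- Odd r gives r² ≡ 1 modulo 8, hence n k ≡ 7, which exchanges the classes 3 and 5.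
    class : ∀ n k r → n % 8 ≡ 3 ⊎ n % 8 ≡ 5 → Odd r → r * r ≡ 2 + n * k → k % 8 ≡ 3 ⊎ k % 8 ≡ 5
    class n k _ n%8 (j , refl) eq = [ (λ e → either (consequence 8 (equation ++ (v₀ , con 3) ∷ []) isClass _ (n ∷ k ∷ j ∷ []) (cong (_% 8) eq ∷ e ∷ [])))
                                  , (λ e → either (consequence 8 (equation ++ (v₀ , con 5) ∷ []) isClass _ (n ∷ k ∷ j ∷ []) (cong (_% 8) eq ∷ e ∷ []))) ]′ n%8
      where
      equation : System 3
      equation = ((con 1 ⊕ con 2 ⊗ v₂) ⊗ (con 1 ⊕ con 2 ⊗ v₂) , con 2 ⊕ v₀ ⊗ v₁) ∷ []
      isClass : Vec ℕ 3 → Bool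
      isClass (_ ∷ k ∷ _) = (k ≡ᵇ 3) ∨ (k ≡ᵇ 5)
      either : T ((k % 8 ≡ᵇ 3) ∨ (k % 8 ≡ᵇ 5)) → k % 8 ≡ 3 ⊎ k % 8 ≡ 5
      either = map₁ (≡ᵇ⇒≡ _ _) ∘ map₂ (≡ᵇ⇒≡ _ _) ∘ Equivalence.to T-∨
    big : ∀ k → k % 8 ≡ 3 ⊎ k % 8 ≡ 5 → ∃ λ c → k ≡ 2 + c
    big 0 (inj₁ ())
    big 0 (inj₂ ())
    big 1 (inj₁ ())
    big 1 (inj₂ ())
    big (suc (suc c)) _ = c , refl
    smaller : ∀ {n k r} → r < n → r * r ≡ 2 + n * k → k < n
    smaller {n} {k} {r} r<n eq = *-cancelˡ-< n k n (≤-<-trans (subst (n * k ≤_) (sym eq) (m≤n+m _ 2)) (*-mono-< r<n r<n))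

opaque
  -2-nonresidue : ∀ n → n % 8 ≡ 5 ⊎ n % 8 ≡ 7 → ∀ x → ¬ n ∣ x * x + 2
  -2-nonresidue = <-rec _ λ n rec n%8 x n∣ →
    let r , _ , r<n , _ , r-odd , _ , divides k eq , _ = root-of-each-parity x 2 (n-odd n n%8) (n∤2 n%8) n∣
        eq′ = trans eq (*-comm k n)
    in rec (smaller r<n r-odd eq′) (class n k r n%8 r-odd eq′) r (divides n eq′)
    where
    n-odd : ∀ n → n % 8 ≡ 5 ⊎ n % 8 ≡ 7 → Odd n
    n-odd n = [ odd-if ∘ reduce-% n 2 (divides 4 refl) , odd-if ∘ reduce-% n 2 (divides 4 refl) ]′
    n∤2 : ∀ {n} → n % 8 ≡ 5 ⊎ n % 8 ≡ 7 → ¬ n ∣ 2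
    n∤2 {0} (inj₁ ())
    n∤2 {0} (inj₂ ())
    n∤2 {1} (inj₁ ())
    n∤2 {1} (inj₂ ())
    n∤2 {2} (inj₁ ())
    n∤2 {2} (inj₂ ())
    n∤2 {suc (suc (suc n))} _ n∣2 = <⇒≱ (m≤m+n 3 n) (∣⇒≤ n∣2)
    -- Here n k = r² + 2 ≡ 3 modulo 8, which exchanges the classes 5 and 7.
    class : ∀ n k r → n % 8 ≡ 5 ⊎ n % 8 ≡ 7 → Odd r → r * r + 2 ≡ n * k → k % 8 ≡ 5 ⊎ k % 8 ≡ 7
    class n k _ n%8 (j , refl) eq =
      [ (λ e → either (consequence 8 (equation ++ (v₀ , con 5) ∷ []) isClass _ (n ∷ k ∷ j ∷ []) (cong (_% 8) eq ∷ e ∷ [])))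
      , (λ e → either (consequence 8 (equation ++ (v₀ , con 7) ∷ []) isClass _ (n ∷ k ∷ j ∷ []) (cong (_% 8) eq ∷ e ∷ []))) ]′ n%8
      where
      equation : System 3
      equation = ((con 1 ⊕ con 2 ⊗ v₂) ⊗ (con 1 ⊕ con 2 ⊗ v₂) ⊕ con 2 , v₀ ⊗ v₁) ∷ []
      isClass : Vec ℕ 3 → Bool
      isClass (_ ∷ k ∷ _) = (k ≡ᵇ 5) ∨ (k ≡ᵇ 7)
      either : T ((k % 8 ≡ᵇ 5) ∨ (k % 8 ≡ᵇ 7)) → k % 8 ≡ 5 ⊎ k % 8 ≡ 7
      either = map₁ (≡ᵇ⇒≡ _ _) ∘ map₂ (≡ᵇ⇒≡ _ _) ∘ Equivalence.to T-∨
    smaller : ∀ {n k r} → r < n → Odd r → r * r + 2 ≡ n * k → k < n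
    smaller {k = k} {r} r<n (j , refl) eq with m≤n⇒∃[o]m+o≡n r<n
    ... | e , refl = *-cancelˡ-< (suc r + e) k (suc r + e) (subst₂ _<_ eq (sym (expand j e)) (m<m+n _ z<s))
      where expand : ∀ j e → (2 + 2 * j + e) * (2 + 2 * j + e) ≡
                     (1 + 2 * j) * (1 + 2 * j) + 2 + suc (4 * j + e * e + 2 * e * (2 + 2 * j))
            expand = solve-∀

opaque
  -1-nonresidue : ∀ n → n % 4 ≡ 3 → ∀ x → ¬ n ∣ x * x + 1
  -1-nonresidue = <-rec _ λ n rec n%4 x n∣ →
    let _ , s , _ , s<n , _ , s-even , _ , divides k eq = root-of-each-parity x 1
          (odd-if (reduce-% n 2 (divides 2 refl) n%4)) (n∤1 n%4) n∣
        eq′ = trans eq (*-comm k n)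
    in rec (smaller n%4 s<n eq′) (class n k s n%4 s-even eq′) s (divides n eq′)
    where
    n∤1 : ∀ {n} → n % 4 ≡ 3 → ¬ n ∣ 1
    n∤1 n%4 n∣1 with ∣1⇒≡1 n∣1 | n%4
    ... | refl | ()
    -- The even root serves here: s² + 1 ≡ 1 modulo 4, so n ≡ 3 gives k ≡ 3.
    class : ∀ n k s → n % 4 ≡ 3 → Even s → s * s + 1 ≡ n * k → k % 4 ≡ 3
    class n k _ n%4 (j , refl) eq = ≡ᵇ⇒≡ _ _ (consequence 4
      ((con 2 ⊗ v₂ ⊗ (con 2 ⊗ v₂) ⊕ con 1 , v₀ ⊗ v₁) ∷ (v₀ , con 3) ∷ [])
      (λ { (_ ∷ k ∷ _) → k ≡ᵇ 3 }) _ (n ∷ k ∷ j ∷ []) (cong (_% 4) eq ∷ n%4 ∷ []))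
    smaller : ∀ {n k s} → n % 4 ≡ 3 → s < n → s * s + 1 ≡ n * k → k < n
    smaller {n} {k} {zero} n%4 _ eq = contradiction (divides k (trans eq (*-comm n k))) (n∤1 n%4)
    smaller {k = k} {suc s} _ s<n eq with m≤n⇒∃[o]m+o≡n s<n
    ... | e , refl = *-cancelˡ-< (2 + s + e) k (2 + s + e) (subst₂ _<_ eq (sym (expand s e)) (m<m+n _ z<s))
      where expand : ∀ s e → (2 + s + e) * (2 + s + e) ≡
                     (1 + s) * (1 + s) + 1 + suc (1 + 2 * s + e * e + 2 * e * (2 + s))
            expand = solve-∀

-- The square sidesteps the sign in Bézout's identity.
opaque
  invert : ∀ {p y} → Coprime p y → ∃ λ v → ∃₂ λ i j → v * y * (v * y) + p * i ≡ 1 + p * j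
  invert {p} {y} p⊥y with coprime-Bézout p⊥y
  ... | Bézout.-+ u v eq = v , 0 , u * (2 + u * p) , trans (cong (λ w → w * w + p * 0) (sym eq)) (expand u p)
    where expand : ∀ u p → (1 + u * p) * (1 + u * p) + p * 0 ≡ 1 + p * (u * (2 + u * p))
          expand = solve-∀
  ... | Bézout.+- u v eq = v , 2 * u , u * u * p , trans (cong (v * y * (v * y) +_) (trans (double p u) (cong (2 *_) (sym eq))))
          (trans (expand (v * y)) (trans (cong (λ w → 1 + w * w) eq) (regroup u p)))
    where double : ∀ p u → p * (2 * u) ≡ 2 * (u * p)
          double = solve-∀
          expand : ∀ w → w * w + 2 * (1 + w) ≡ 1 + (1 + w) * (1 + w)
          expand = solve-∀
          regroup : ∀ u p → 1 + u * p * (u * p) ≡ 1 + p * (u * u * p)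
          regroup = solve-∀

-- If p divided y it would divide x. Otherwise y has an inverse v modulo p, up to sign, and
-- multiplying the form by v² leaves (x v)² + c.
prime-∤-norm : ∀ {p} c → Prime p → (∀ x → ¬ p ∣ x * x + c) → ∀ x y → Coprime p x → ¬ p ∣ x * x + c * (y * y)
prime-∤-norm {p} c pp nr x y p⊥x p∣ with prime-coprime-or-∣ pp y
... | inj₂ p∣y = prime∤1 pp (∣-reflexive (p⊥x (∣-refl ,
  prime-∣² pp (∣m+n∣m⇒∣n (subst (p ∣_) (+-comm (x * x) _) p∣) (∣n⇒∣m*n c (∣m⇒∣m*n y p∣y))))))
... | inj₁ p⊥y with invert p⊥y
... | v , i , j , eq = nr (x * v) (∣m+n∣m⇒∣n {m = p * (c * j)} (subst (p ∣_)
  (trans (expand x y v c p i) (trans (cong (λ w → x * v * (x * v) + c * w) eq) (regroup x v c p j)))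
  (∣m∣n⇒∣m+n (∣m⇒∣m*n (v * v) p∣) (m∣m*n (c * i)))) (m∣m*n _))
  where
  expand : ∀ x y v c p i → (x * x + c * (y * y)) * (v * v) + p * (c * i) ≡ x * v * (x * v) + c * (v * y * (v * y) + p * i)
  expand = solve-∀
  regroup : ∀ x v c p j → x * v * (x * v) + c * (1 + p * j) ≡ p * (c * j) + (x * v * (x * v) + c)
  regroup = solve-∀

-- Neither 2 nor -2 is a square modulo p, in homogeneous form. The congruence x² ≡ 2y² takes two
-- fields, one for each sign of the difference.
record TwoNonresidue (p : ℕ) : Set where
  field
    x²≢2y² : ∀ x y z → Coprime p x → x * x ≢ 2 * (y * y) + p * z
    2y²≢x² : ∀ x y z → Coprime p x → 2 * (y * y) ≢ x * x + p * z
    x²+2y²≢0 : ∀ x y z → Coprime p x → x * x + 2 * (y * y) ≢ p * z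

opaque
  two-nonresidue : ∀ {p} → Prime p → p % 8 ≡ 5 → TwoNonresidue p
  two-nonresidue {zero} _ ()
  two-nonresidue {suc zero} _ ()
  two-nonresidue {p@(suc (suc c))} pp p%8 = record
    { x²≢2y² = λ x y z p⊥x eq → no-root x y p⊥x
        (divides (y * y + z) (trans (cong (_+ c * (y * y)) eq) (add₁ y z c)))
    ; 2y²≢x² = λ x y z p⊥x eq → no-root x y p⊥x (∣m+n∣m⇒∣n {m = p * z}
        (divides (y * y) (trans (add₂ x y z c) (trans (cong (_+ c * (y * y)) (sym eq)) (add₃ y c)))) (m∣m*n z))
    ; x²+2y²≢0 = λ x y z p⊥x eq → prime-∤-norm 2 pp (-2-nonresidue p (inj₁ p%8)) x y p⊥x (divides z (trans eq (*-comm p z)))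
    }
    where
    -- Since c = p - 2, this form is x² - 2y² modulo p.
    no-root : ∀ x y → Coprime p x → ¬ p ∣ x * x + c * (y * y)
    no-root = prime-∤-norm c pp (2-nonresidue p c (inj₂ p%8) refl)
    add₁ : ∀ y z c → 2 * (y * y) + (2 + c) * z + c * (y * y) ≡ (y * y + z) * (2 + c)
    add₁ = solve-∀
    add₂ : ∀ x y z c → (2 + c) * z + (x * x + c * (y * y)) ≡ x * x + (2 + c) * z + c * (y * y)
    add₂ = solve-∀
    add₃ : ∀ y c → 2 * (y * y) + c * (y * y) ≡ y * y * (2 + c)
    add₃ = solve-∀

-- Infinite descent

opaque
  -- If f and r are both nonzero, then f < 2 f r = k and the induction hypothesis f = 0 is absurd;
  -- so one of them is 0, and k with it. The factor 2 makes the step strict even for r = 1.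
  descent : (P : ℕ → Set) → (∀ k → P k → ∃₂ λ f r → k ≡ 2 * (f * r) × P f) → ∀ k → P k → k ≡ 0
  descent P step = <-rec _ go
    where
    go : ∀ k → (∀ {f} → f < k → P f → f ≡ 0) → P k → k ≡ 0
    go zero      rec Pk = refl
    go k@(suc _) rec Pk with step k Pk
    ... | f , zero , k≡ , Pf = trans k≡ (cong (2 *_) (*-zeroʳ f))
    ... | zero , r , k≡ , Pf = k≡
    ... | f@(suc _) , r@(suc _) , k≡ , Pf = contradiction (rec f<k Pf) λ ()
      where f<k : f < k
            f<k = subst (f <_) (sym k≡) (≤-<-trans (m≤m*n f r)
                    (m<m+n (f * r) {f * r + 0} z<s))

-- The squares a², c², b² are in progression with difference D k². For nonzero k such a triple
-- exhibits D as a congruent number.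
PrimitiveAP : ℕ → ℕ → Set
PrimitiveAP D k = ∃ λ a → ∃ λ c → ∃ λ b →
  Coprime a k × c * c ≡ a * a + D * (k * k) × b * b ≡ c * c + D * (k * k)

opaque
  -- Odd k is impossible modulo 4, so k = 2κ and a is odd. With x = (b - a) / 2 the progression
  -- turns into a right triangle with legs x and x + a, hypotenuse c and area D κ².
  ap-split : ∀ D k a b c → D % 4 ≡ 1 ⊎ D % 4 ≡ 2 → Coprime a k →
    c * c ≡ a * a + D * (k * k) → b * b ≡ c * c + D * (k * k) →
    ∃₂ λ κ x → k ≡ 2 * κ × Odd a × x * (x + a) ≡ 2 * D * (κ * κ) × c * c ≡ x * x + (x + a) * (x + a)
  ap-split D k a b c D%4 a⊥k eq₁ eq₂ with even-or-odd k
  ... | inj₂ (κ , refl) = ⊥-elim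
    ([ (λ e → insoluble 4 ((v₃ , con 1) ∷ odd-difference) _ (κ ∷ a ∷ b ∷ D ∷ c ∷ []) (e ∷ cong (_% 4) eq₁ ∷ cong (_% 4) eq₂ ∷ []))
     , (λ e → insoluble 4 ((v₃ , con 2) ∷ odd-difference) _ (κ ∷ a ∷ b ∷ D ∷ c ∷ []) (e ∷ cong (_% 4) eq₁ ∷ cong (_% 4) eq₂ ∷ [])) ]′ D%4)
    where
    odd-difference : System 5
    odd-difference = (v₄ ⊗ v₄ , v₁ ⊗ v₁ ⊕ v₃ ⊗ ((con 1 ⊕ con 2 ⊗ v₀) ⊗ (con 1 ⊕ con 2 ⊗ v₀)))
                   ∷ (v₂ ⊗ v₂ , v₄ ⊗ v₄ ⊕ v₃ ⊗ ((con 1 ⊕ con 2 ⊗ v₀) ⊗ (con 1 ⊕ con 2 ⊗ v₀))) ∷ []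
  ... | inj₁ (κ , refl) with coprime-even⇒odd (κ , refl) (coprime-sym a⊥k)
  ... | a-odd with square-gap {b = b} (2 * D * (κ * κ)) a-odd (trans eq₂ (trans (cong (_+ D * (2 * κ * (2 * κ))) eq₁) (collect a D κ)))
    where collect : ∀ a D κ → a * a + D * (2 * κ * (2 * κ)) + D * (2 * κ * (2 * κ)) ≡ a * a + 4 * (2 * D * (κ * κ))
          collect = solve-∀
  ... | x , _ , x[x+a]≡ = κ , x , refl , a-odd , x[x+a]≡ ,
    trans eq₁ (trans (half a D κ) (trans (cong (λ w → a * a + 2 * w) (sym x[x+a]≡)) (squares a x)))
    where half : ∀ a D κ → a * a + D * (2 * κ * (2 * κ)) ≡ a * a + 2 * (2 * D * (κ * κ))
          half = solve-∀
          squares : ∀ a x → a * a + 2 * (x * (x + a)) ≡ x * x + (x + a) * (x + a)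
          squares = solve-∀

opaque
  -- Splitting c² - v⁴ = 4u⁴ gives f⁴ + v² = g⁴ with u = f g. Then v² = (g² - f²)(g² + f²) has
  -- coprime factors h² and j², and h², g², j² are in progression with difference f².
  sum-x⁴-4y⁴ : ∀ u v c → Odd v → Coprime v u → c * c ≡ v * v * (v * v) + 4 * (u * u * (u * u)) →
               ∃₂ λ f g → u ≡ f * g × PrimitiveAP 1 f
  sum-x⁴-4y⁴ u v c v-odd v⊥u eq with square-gap {b = c} (u * u * (u * u)) (Odd-* v-odd v-odd) eq
  ... | z , _ , z[z+v²]≡ with coprime-fourth z (z + v * v) u
      (coprime-+ˡ ∣-refl (coprime-∣ˡ (subst (z ∣_) z[z+v²]≡ (m∣m*n _)) (coprime-sym (coprime-² (coprime-²ʳ v⊥u))))) z[z+v²]≡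
  ... | f , g , refl , f⁴+v²≡g⁴ , refl
    with m≤n⇒∃[o]m+o≡n (sq-cancel-≤ {f * f} {g * g} (subst (f * f * (f * f) ≤_) f⁴+v²≡g⁴ (m≤m+n _ _)))
  ... | e , f²+e≡g² with coprime-square e (e + 2 * (f * f)) v e⊥ e[e+2f²]≡
    where
    expand : ∀ f e → f * f * (f * f) + e * (e + 2 * (f * f)) ≡ (f * f + e) * (f * f + e)
    expand = solve-∀
    e[e+2f²]≡ : e * (e + 2 * (f * f)) ≡ v * v
    e[e+2f²]≡ = +-cancelˡ-≡ (f * f * (f * f)) _ _ (trans (expand f e) (trans (cong₂ _*_ f²+e≡g² f²+e≡g²) (sym f⁴+v²≡g⁴)))
    e∣v² : e ∣ v * v
    e∣v² = subst (e ∣_) e[e+2f²]≡ (m∣m*n _)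
    e⊥ : Coprime e (e + 2 * (f * f))
    e⊥ = coprime-+ˡ ∣-refl (coprime-∣ˡ e∣v² (coprime-*ʳ {b = 2} {c = f * f} (coprime-sym (coprime-odd (Odd-* v-odd v-odd)))
           (coprime-² {b = f} (coprime-∣ʳ (m∣m*n g) v⊥u))))
  ... | h , j , refl , h²+2f²≡j² , refl = f , g , refl , h , g , j
    , coprime-∣ (m∣m*n j) (m∣m*n g) v⊥u , trans (sym f²+e≡g²) (swap f h)
    , trans (sym h²+2f²≡j²) (trans (shift f h) (cong (_+ 1 * (f * f)) f²+e≡g²))
    where swap : ∀ f h → f * f + h * h ≡ h * h + 1 * (f * f)
          swap = solve-∀
          shift : ∀ f h → h * h + 2 * (f * f) ≡ f * f + h * h + 1 * (f * f)
          shift = solve-∀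

opaque
  -- For D = 1 the coprime legs have product 2κ², so they are 2u² and v² in some order, and the
  -- hypotenuse satisfies c² = v⁴ + 4u⁴.
  ap-1-half : ∀ {x y u v κ c} → Coprime x y → x ≡ 2 * (u * u) → y ≡ v * v → κ ≡ u * v → c * c ≡ x * x + y * y →
         ∃₂ λ f r → 2 * κ ≡ 2 * (f * r) × PrimitiveAP 1 f
  ap-1-half {u = u} {v} {c = c} x⊥y refl refl refl sum =
    let f , g , u≡fg , ap = sum-x⁴-4y⁴ u v c v-odd v⊥u (trans sum (rearrange u v))
    in f , g * v , cong (2 *_) (trans (cong (_* v) u≡fg) (*-assoc f g v)) , ap
    where
    v-odd : Odd v
    v-odd = odd-coprime (coprime-∣ {2 * (u * u)} {2} {v * v} {v} (m∣m*n (u * u)) (m∣m*n v) x⊥y)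
    v⊥u : Coprime v u
    v⊥u = coprime-∣ {v * v} {v} {2 * (u * u)} {u} (m∣m*n v) (∣n⇒∣m*n 2 (m∣m*n u)) (coprime-sym x⊥y)
    rearrange : ∀ u v → 2 * (u * u) * (2 * (u * u)) + v * v * (v * v) ≡ v * v * (v * v) + 4 * (u * u * (u * u))
    rearrange = solve-∀

ap-1-step : ∀ {k a c} → Coprime a k →
  (∃₂ λ κ x → k ≡ 2 * κ × Odd a × x * (x + a) ≡ 2 * 1 * (κ * κ) × c * c ≡ x * x + (x + a) * (x + a)) →
  ∃₂ λ f r → k ≡ 2 * (f * r) × PrimitiveAP 1 f
ap-1-step {a = a} {c} a⊥k (κ , x , refl , _ , prod , sum) =
  [ (λ (u , v , x≡ , y≡ , κ≡) → ap-1-half {u = u} {v} {κ} {c} x⊥x+a x≡ y≡ κ≡ sum)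
  , (λ (v , u , x≡ , y≡ , κ≡) → ap-1-half {u = u} {v} {κ} {c} (coprime-sym x⊥x+a) y≡ x≡ (trans κ≡ (*-comm v u)) (trans sum (+-comm (x * x) _))) ]′
  (primary-square (primary-prime prime[2]) x (x + a) κ x⊥x+a prod)
  where
  k² : ∀ κ → 2 * (2 * 1 * (κ * κ)) ≡ 2 * κ * (2 * κ)
  k² = solve-∀
  x∣k² : x ∣ 2 * κ * (2 * κ)
  x∣k² = subst (x ∣_) (trans (cong (2 *_) prod) (k² κ)) (∣n⇒∣m*n 2 (m∣m*n _))
  x⊥x+a : Coprime x (x + a)
  x⊥x+a = coprime-+ˡ ∣-refl (coprime-∣ˡ x∣k² (coprime-sym (coprime-²ʳ a⊥k)))

primitive-ap-1 : ∀ k → PrimitiveAP 1 k → k ≡ 0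
primitive-ap-1 = descent (PrimitiveAP 1) λ k (a , c , b , a⊥k , eq₁ , eq₂) → ap-1-step {c = c} a⊥k (ap-split 1 k a b c (inj₁ refl) a⊥k eq₁ eq₂)

-- Four coprime factors, and progressions with difference 2c k²

data Spread (c a b d e k : ℕ) : Set where
  on₁ : ∀ x y z w → a ≡ c * (x * x) → b ≡ y * y → d ≡ z * z → e ≡ w * w → k ≡ x * (y * (z * w)) → Spread c a b d e k
  on₂ : ∀ x y z w → a ≡ x * x → b ≡ c * (y * y) → d ≡ z * z → e ≡ w * w → k ≡ x * (y * (z * w)) → Spread c a b d e k
  on₃ : ∀ x y z w → a ≡ x * x → b ≡ y * y → d ≡ c * (z * z) → e ≡ w * w → k ≡ x * (y * (z * w)) → Spread c a b d e k
  on₄ : ∀ x y z w → a ≡ x * x → b ≡ y * y → d ≡ z * z → e ≡ c * (w * w) → k ≡ x * (y * (z * w)) → Spread c a b d e k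

opaque
  -- The nested coprimality lets `primary-square` be repeated until c has found its factor, and
  -- `coprime-square` from there on.
  spread : ∀ {c} .{{_ : NonZero c}} → Primary c → ∀ a b d e k →
           Coprime a (b * (d * e)) → Coprime b (d * e) → Coprime d e →
           a * (b * (d * e)) ≡ c * (k * k) → Spread c a b d e k
  spread prim a b d e k a⊥bde b⊥de d⊥e eq with primary-square prim a (b * (d * e)) k a⊥bde eq
  ... | inj₁ (x , m , a≡ , bde≡m² , refl) with coprime-square b (d * e) m b⊥de bde≡m²
  ...   | y , n , b≡ , de≡n² , refl with coprime-square d e n d⊥e de≡n²
  ...     | z , w , d≡ , e≡ , refl = on₁ x y z w a≡ b≡ d≡ e≡ refl
  spread prim a b d e k a⊥bde b⊥de d⊥e eq | inj₂ (x , m , a≡ , bde≡cm² , refl)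
    with primary-square prim b (d * e) m b⊥de bde≡cm²
  ... | inj₁ (y , n , b≡ , de≡n² , refl) with coprime-square d e n d⊥e de≡n²
  ...   | z , w , d≡ , e≡ , refl = on₂ x y z w a≡ b≡ d≡ e≡ refl
  spread prim a b d e k a⊥bde b⊥de d⊥e eq | inj₂ (x , m , a≡ , bde≡cm² , refl)
      | inj₂ (y , n , b≡ , de≡cn² , refl) with primary-square prim d e n d⊥e de≡cn²
  ... | inj₁ (z , w , d≡ , e≡ , refl) = on₃ x y z w a≡ b≡ d≡ e≡ refl
  ... | inj₂ (z , w , d≡ , e≡ , refl) = on₄ x y z w a≡ b≡ d≡ e≡ refl

-- The outcome `on₁` on its own. For c = 1 all four outcomes reduce to it; for the primes c,
-- nonresidues exclude the other three.
record AllSquares (c a b d e k : ℕ) : Set where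
  constructor squares
  field
    x y z w : ℕ
    a≡ : a ≡ c * (x * x)
    b≡ : b ≡ y * y
    d≡ : d ≡ z * z
    e≡ : e ≡ w * w
    k≡ : k ≡ x * (y * (z * w))

one* : ∀ {m n} → m ≡ n → m ≡ 1 * n
one* {n = n} eq = trans eq (sym (*-identityˡ n))

one*⁻¹ : ∀ {m n} → m ≡ 1 * n → m ≡ n
one*⁻¹ {n = n} eq = trans eq (*-identityˡ n)

spread-1 : ∀ {a b d e k} → Spread 1 a b d e k → AllSquares 1 a b d e k
spread-1 (on₁ x y z w a≡ b≡ d≡ e≡ k≡) = squares x y z w a≡ b≡ d≡ e≡ k≡
spread-1 (on₂ x y z w a≡ b≡ d≡ e≡ k≡) = squares x y z w (one* a≡) (one*⁻¹ b≡) d≡ e≡ k≡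
spread-1 (on₃ x y z w a≡ b≡ d≡ e≡ k≡) = squares x y z w (one* a≡) b≡ (one*⁻¹ d≡) e≡ k≡
spread-1 (on₄ x y z w a≡ b≡ d≡ e≡ k≡) = squares x y z w (one* a≡) b≡ d≡ (one*⁻¹ e≡) k≡

-- Instantiated with c = 1 and with primes c ≡ 5 (mod 8).  In a progression a², h², (a + 2x)² with
-- difference 2c(2κ)², the numbers x, x + a, h are the sides of a right triangle with x(x + a) = 4cκ².
-- Its legs are 2ν(ν + l) and l(2ν + l), so the coprime numbers ν, l, ν + l, 2ν + l have product 2cκ².
module EvenDifference (c : ℕ) .{{_ : NonZero c}} (primary : Primary c) (c%4≡1 : c % 4 ≡ 1)
  (squarefree : ∀ {d} → d * d ∣ c → d ≡ 1) (c≡1-or-nr : c ≡ 1 ⊎ TwoNonresidue c) where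

  Smaller : ℕ → Set
  Smaller κ = ∃₂ λ x r → κ ≡ x * r × PrimitiveAP (2 * c) x

  opaque
    -- Here ν = 2n. In outcome `on₁` the numbers l, 2n + l, 4n + l are squares in progression with
    -- difference 2c x², the smaller instance. Each other outcome makes 2 or -2 a square modulo c.
    apex-even : ∀ n l κ → Odd l → Coprime n l → Spread c n l (2 * n + l) (2 * n + (2 * n + l)) κ → Smaller κ
    apex-even n l κ l-odd n⊥l sp = [ trivial , nonresidue ]′ c≡1-or-nr
      where
      rotate : ∀ c x f → 2 * (c * (x * x)) + f ≡ f + 2 * c * (x * x)
      rotate = solve-∀
      finish : AllSquares c n l (2 * n + l) (2 * n + (2 * n + l)) κ → Smaller κ
      finish (squares x f m g refl refl m²≡ g²≡ κ≡) = x , f * (m * g) , κ≡ , f , m , g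
        , coprime-∣ (m∣m*n f) (∣n⇒∣m*n c (m∣m*n x)) (coprime-sym n⊥l)
        , trans (sym m²≡) (rotate c x (f * f))
        , trans (sym g²≡) (trans (cong (2 * n +_) m²≡) (rotate c x (m * m)))
      trivial : c ≡ 1 → Smaller κ
      trivial refl = finish (spread-1 sp)
      nonresidue : TwoNonresidue c → Smaller κ
      nonresidue nr = go sp
        where
        open TwoNonresidue nr
        2⊥m : Coprime 2 (2 * n + l)
        2⊥m = coprime-+ˡ (m∣m*n n) (coprime-odd l-odd)
        n⊥m : Coprime n (2 * n + l)
        n⊥m = coprime-+ˡ (∣n⇒∣m*n 2 ∣-refl) n⊥l
        m⊥s : Coprime (2 * n + l) (2 * n + (2 * n + l))
        m⊥s = coprime-+ʳ ∣-refl (coprime-sym (coprime-*ˡ {2} {n} 2⊥m n⊥m))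
        l⊥m : Coprime l (2 * n + l)
        l⊥m = coprime-+ʳ ∣-refl (coprime-*ʳ {b = 2} (coprime-sym (coprime-odd l-odd)) (coprime-sym n⊥l))
        factor : ∀ {n d e} → n ≡ d * e → d ∣ n
        factor {e = e} refl = m∣m*n e
        go : Spread c n l (2 * n + l) (2 * n + (2 * n + l)) κ → Smaller κ
        go (on₁ x f m g a b d e k) = finish (squares x f m g a b d e k)
        go (on₂ x f m g refl refl m²≡ _ _) = ⊥-elim (x²≢2y² m x (f * f) (coprime-∣ (m∣m*n (f * f)) (factor m²≡) l⊥m) (sym m²≡))
        go (on₃ x f m g refl refl m²≡ _ _) = ⊥-elim (x²+2y²≢0 f x (m * m) (coprime-∣ (factor m²≡) (m∣m*n f) (coprime-sym l⊥m)) (trans (+-comm (f * f) _) m²≡))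
        go (on₄ x f m g refl refl m²≡ g²≡ _) = ⊥-elim (x²+2y²≢0 m x (g * g) (coprime-∣ (factor g²≡) (factor m²≡) (coprime-sym m⊥s)) (trans (+-comm (m * m) _) (trans (cong (2 * (x * x) +_) (sym m²≡)) g²≡)))

  opaque
    -- Outcome `on₁` fails modulo 4: n and l would be odd squares, so n + 2m = 2n + l ≡ 3 is not a
    -- square. Each other outcome makes 2 or -2 a square modulo c.
    apex-odd : ∀ m n l κ → Odd n → Coprime n l → n + l ≡ 2 * m → ¬ Spread c m n l (n + 2 * m) κ
    apex-odd m n l κ n-odd n⊥l n+l≡2m sp = [ trivial , nonresidue ]′ c≡1-or-nr
      where
      mod-4 : ¬ AllSquares c m n l (n + 2 * m) κ
      mod-4 (squares x y f g refl refl refl g²≡ _) with Odd-*⁻ˡ y y n-odd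
      ... | j , refl = insoluble 4
        ( (v₄ , con 1)
        ∷ ((con 1 ⊕ con 2 ⊗ v₀) ⊗ (con 1 ⊕ con 2 ⊗ v₀) ⊕ v₁ ⊗ v₁ , con 2 ⊗ (v₄ ⊗ (v₃ ⊗ v₃)))
        ∷ ((con 1 ⊕ con 2 ⊗ v₀) ⊗ (con 1 ⊕ con 2 ⊗ v₀) ⊕ con 2 ⊗ (v₄ ⊗ (v₃ ⊗ v₃)) , v₂ ⊗ v₂) ∷ [])
        _ (j ∷ f ∷ g ∷ x ∷ c ∷ []) (c%4≡1 ∷ cong (_% 4) n+l≡2m ∷ cong (_% 4) g²≡ ∷ [])
      trivial : c ≡ 1 → ⊥
      trivial refl = mod-4 (spread-1 sp)
      nonresidue : TwoNonresidue c → ⊥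
      nonresidue nr = go sp
        where
        open TwoNonresidue nr
        n⊥s : Coprime n (n + 2 * m)
        n⊥s = coprime-+ˡ ∣-refl (subst (Coprime n) n+l≡2m (coprime-+ˡ ∣-refl n⊥l))
        go : ¬ Spread c m n l (n + 2 * m) κ
        go (on₁ x y f g a b d e k) = mod-4 (squares x y f g a b d e k)
        go (on₂ x y f g refl refl refl _ _) = 2y²≢x² f x (y * y) (coprime-∣ (m∣m*n (y * y)) (m∣m*n f) n⊥l)
          (trans (sym n+l≡2m) (+-comm (c * (y * y)) (f * f)))
        go (on₃ x y f g refl refl refl _ _) = 2y²≢x² y x (f * f)
          (coprime-∣ (m∣m*n (f * f)) (m∣m*n y) (coprime-sym n⊥l)) (sym n+l≡2m)
        go (on₄ x y f g refl refl _ s≡ _) = x²+2y²≢0 y x (g * g)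
          (coprime-∣ (subst (c ∣_) (sym s≡) (m∣m*n (g * g))) (m∣m*n y) (coprime-sym n⊥s)) s≡

  opaque
    -- The four numbers are pairwise coprime because l is odd. The factor 2 of their product belongs
    -- to n or, for odd n, to n + l.
    apex : ∀ n l κ → Odd l → Coprime n l → n * (l * ((n + l) * (n + (n + l)))) ≡ 2 * (c * (κ * κ)) → Smaller κ
    apex n l κ l-odd n⊥l eq = cases (even-or-odd n)
      where
      n⊥m : Coprime n (n + l)
      n⊥m = coprime-+ˡ ∣-refl n⊥l
      n⊥s : Coprime n (n + (n + l))
      n⊥s = coprime-+ˡ ∣-refl n⊥m
      l⊥m : Coprime l (n + l)
      l⊥m = coprime-+ʳ ∣-refl (coprime-sym n⊥l)
      l⊥s : Coprime l (n + (n + l))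
      l⊥s = subst (Coprime l) (regroup n l) (coprime-+ʳ ∣-refl (coprime-*ʳ {b = 2} (coprime-sym (coprime-odd l-odd)) (coprime-sym n⊥l)))
        where regroup : ∀ n l → 2 * n + l ≡ n + (n + l)
              regroup = solve-∀
      m⊥s : Coprime (n + l) (n + (n + l))
      m⊥s = coprime-+ʳ ∣-refl (coprime-sym n⊥m)
      cases : Even n ⊎ Odd n → Smaller κ
      cases (inj₁ (n′ , refl)) = apex-even n′ l κ l-odd (coprime-∣ˡ n′∣n n⊥l)
        (spread primary n′ l (2 * n′ + l) (2 * n′ + (2 * n′ + l)) κ
          (coprime-∣ˡ n′∣n (coprime-*ʳ n⊥l (coprime-*ʳ n⊥m n⊥s))) (coprime-*ʳ l⊥m l⊥s) m⊥s
          (*-cancelˡ-≡ _ _ 2 (trans (sym (*-assoc 2 n′ _)) eq)))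
        where n′∣n : n′ ∣ 2 * n′
              n′∣n = ∣n⇒∣m*n 2 ∣-refl
      cases (inj₂ n-odd) with Odd-+⇒Even n-odd l-odd
      ... | m , n+l≡2m = ⊥-elim (apex-odd m n l κ n-odd n⊥l n+l≡2m
        (spread primary m n l (n + 2 * m) κ
          (coprime-∣ˡ m∣ (coprime-*ʳ (coprime-sym n⊥m) (coprime-*ʳ (coprime-sym l⊥m) m⊥s′)))
          (coprime-*ʳ n⊥l (subst (λ x → Coprime n (n + x)) n+l≡2m n⊥s))
          (subst (λ x → Coprime l (n + x)) n+l≡2m l⊥s)
          (*-cancelˡ-≡ _ _ 2 (trans (reorder m n l (n + 2 * m)) (trans (cong (λ x → n * (l * (x * (n + x)))) (sym n+l≡2m)) eq)))))
        where
        m∣ : m ∣ n + l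
        m∣ = subst (m ∣_) (sym n+l≡2m) (∣n⇒∣m*n 2 ∣-refl)
        m⊥s′ : Coprime (n + l) (n + 2 * m)
        m⊥s′ = subst (λ x → Coprime (n + l) (n + x)) n+l≡2m m⊥s
        reorder : ∀ m n l s → 2 * (m * (n * (l * s))) ≡ n * (l * (2 * m * s))
        reorder = solve-∀

  opaque
    -- Parametrisation of the primitive triple 4e, o, h: the numbers n = (h - o) / 2 and n + o are
    -- coprime with product (2e)², hence squares ν² and μ², and l = μ - ν.
    hypotenuse : ∀ e o h κ → Coprime (4 * e) o → e * o ≡ c * (κ * κ) → h * h ≡ 4 * e * (4 * e) + o * o → Smaller κ
    hypotenuse e o h κ 4e⊥o eo≡ h²≡ =
      let n , _ , n[n+o]≡ = square-gap {b = h} (4 * (e * e)) o-odd (trans h²≡ (rearrange e o))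
          n⊥o = coprime-∣ˡ {4 * e * (4 * e)} (subst (n ∣_) (sym (regroup e)) (∣n⇒∣m*n 4 (subst (n ∣_) n[n+o]≡ (m∣m*n (n + o))))) (coprime-²ˡ 4e⊥o)
          ν , μ , n≡ν² , n+o≡μ² , 2e≡νμ = coprime-square n (n + o) (2 * e) (coprime-+ˡ ∣-refl n⊥o) (trans n[n+o]≡ (quarter e))
      in split n ν μ n⊥o n≡ν² n+o≡μ² 2e≡νμ
      where
      o-odd : Odd o
      o-odd = odd-coprime (coprime-∣ˡ {4 * e} {2} (subst (2 ∣_) (sym (*-assoc 2 2 e)) (m∣m*n (2 * e))) 4e⊥o)
      rearrange : ∀ e o → 4 * e * (4 * e) + o * o ≡ o * o + 4 * (4 * (e * e))
      rearrange = solve-∀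
      regroup : ∀ e → 4 * e * (4 * e) ≡ 4 * (4 * (e * e))
      regroup = solve-∀
      quarter : ∀ e → 4 * (e * e) ≡ 2 * e * (2 * e)
      quarter = solve-∀
      product : ∀ ν l → ν * (l * ((ν + l) * (ν + (ν + l)))) ≡ ν * (ν + l) * (l * (ν + (ν + l)))
      product = solve-∀
      expand : ∀ ν l → ν * ν + l * (ν + (ν + l)) ≡ (ν + l) * (ν + l)
      expand = solve-∀
      split : ∀ n ν μ → Coprime n o → n ≡ ν * ν → n + o ≡ μ * μ → 2 * e ≡ ν * μ → Smaller κ
      split _ ν μ n⊥o refl n+o≡ 2e≡ with m≤n⇒∃[o]m+o≡n (sq-cancel-≤ {ν} {μ} (subst (ν * ν ≤_) n+o≡ (m≤m+n (ν * ν) o)))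
      ... | l , refl = apex ν l κ (Odd-*⁻ˡ l _ (subst Odd o≡ o-odd)) (coprime-∣ (m∣m*n ν) l∣o n⊥o)
              (trans (product ν l) (trans (cong₂ _*_ (sym 2e≡) (sym o≡)) (trans (*-assoc 2 e o) (cong (2 *_) eo≡))))
        where
        o≡ : o ≡ l * (ν + (ν + l))
        o≡ = +-cancelˡ-≡ (ν * ν) _ _ (trans n+o≡ (sym (expand ν l)))
        l∣o : l ∣ o
        l∣o = subst (l ∣_) (sym o≡) (m∣m*n _)

  opaque
    primitive-ap-2c : ∀ k → PrimitiveAP (2 * c) k → k ≡ 0
    primitive-ap-2c = descent (PrimitiveAP (2 * c)) λ k (a , h , b , a⊥k , eq₁ , eq₂) →
        step a h a⊥k (ap-split (2 * c) k a b h (inj₂ 2c%4≡2) a⊥k eq₁ eq₂)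
      where
      2c%4≡2 : 2 * c % 4 ≡ 2
      2c%4≡2 = trans (%-distribˡ-* 2 c 4) (cong (λ r → 2 * r % 4) c%4≡1)
      primary-4 : Primary 4
      primary-4 = primary-² (primary-prime prime[2])
      step : ∀ {k} a h → Coprime a k →
        (∃₂ λ κ x → k ≡ 2 * κ × Odd a × x * (x + a) ≡ 2 * (2 * c) * (κ * κ) × h * h ≡ x * x + (x + a) * (x + a)) →
        ∃₂ λ f r → k ≡ 2 * (f * r) × PrimitiveAP (2 * c) f
      step a h a⊥k (κ , x , refl , _ , prod , sum) = finish
        -- The factor 4 of the product 4 c κ² lies in a single leg, the legs being coprime.
        ([ (λ (e , x≡ , e*≡) → hypotenuse e (x + a) h κ (subst (λ w → Coprime w (x + a)) x≡ x⊥x+a) e*≡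
              (trans sum (cong (λ w → w * w + (x + a) * (x + a)) x≡)))
         , (λ (e , y≡ , *e≡) → hypotenuse e x h κ (subst (λ w → Coprime w x) y≡ (coprime-sym x⊥x+a)) (trans (*-comm e x) *e≡)
              (trans sum (trans (+-comm (x * x) _) (cong (λ w → w * w + x * x) y≡)))) ]′
         (primary-split primary-4 x (x + a) (c * (κ * κ)) x⊥x+a (trans prod (four c (κ * κ)))))
        where
        four : ∀ c k → 2 * (2 * c) * k ≡ 4 * (c * k)
        four = solve-∀
        into-k : ∀ c κ → 2 * (2 * c) * (κ * κ) ≡ 2 * κ * (2 * κ) * c
        into-k = solve-∀
        finish : Smaller κ → ∃₂ λ f r → 2 * κ ≡ 2 * (f * r) × PrimitiveAP (2 * c) f
        finish (f , r , κ≡ , ap) = f , r , cong (2 *_) κ≡ , ap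
        -- A common divisor d divides a, so it is prime to k; as d² divides x (x + a) = c k², it
        -- follows that d² ∣ c.
        x⊥x+a : Coprime x (x + a)
        x⊥x+a {d} (d∣x , d∣x+a) = squarefree (coprime-divisor
          (coprime-² (coprime-∣ˡ (∣m+n∣m⇒∣n d∣x+a d∣x) a⊥k))
          (subst (d * d ∣_) (trans prod (into-k c κ)) (*-pres-∣ d∣x d∣x+a)))

NoAP : ℕ → Set
NoAP D = ∀ k a c b → c * c ≡ a * a + D * (k * k) → b * b ≡ c * c + D * (k * k) → k ≡ 0

opaque
  -- Division by g = gcd(a, k) reaches the primitive case: g² divides c², so g ∣ c, and then in the
  -- same way g ∣ b.
  no-ap : ∀ D → (∀ k → PrimitiveAP D k → k ≡ 0) → NoAP D
  no-ap D none zero a c b eq₁ eq₂ = refl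
  no-ap D none k@(suc _) a c b eq₁ eq₂ with coprime-ratio a k
  ... | a′ , k′ , a′⊥k′ , a≡ , k≡ = divide-out (root-∣ (g²∣ c a a′ a≡ eq₁)) λ c′ c≡ →
        root-∣ (g²∣ b c c′ c≡ eq₂)
    where
    g : ℕ
    g = gcd a k
    factor : ∀ x k g D → x * g * (x * g) + D * (k * g * (k * g)) ≡ g * g * (x * x + D * (k * k))
    factor = solve-∀
    square : ∀ x g → x * g * (x * g) ≡ g * g * (x * x)
    square = solve-∀
    scaled : ∀ y x x′ → x ≡ x′ * g → y * y ≡ x * x + D * (k * k) → y * y ≡ g * g * (x′ * x′ + D * (k′ * k′))
    scaled y x x′ x≡ eq = trans eq (trans (cong₂ (λ v w → v * v + D * (w * w)) x≡ k≡) (factor x′ k′ g D))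
    g²∣ : ∀ y x x′ → x ≡ x′ * g → y * y ≡ x * x + D * (k * k) → g * g ∣ y * y
    g²∣ y x x′ x≡ eq = subst (g * g ∣_) (sym (scaled y x x′ x≡ eq)) (m∣m*n _)
    instance
      nonZero-g² : NonZero (g * g)
      nonZero-g² = m*n≢0 g g {{≢-nonZero (gcd[m,n]≢0 a k (inj₂ λ ()))}} {{≢-nonZero (gcd[m,n]≢0 a k (inj₂ λ ()))}}
    divided : ∀ y y′ x x′ → x ≡ x′ * g → y ≡ y′ * g → y * y ≡ x * x + D * (k * k) → y′ * y′ ≡ x′ * x′ + D * (k′ * k′)
    divided y y′ x x′ x≡ y≡ eq = *-cancelˡ-≡ _ _ (g * g)
      (trans (sym (square y′ g)) (trans (sym (cong₂ _*_ y≡ y≡)) (scaled y x x′ x≡ eq)))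
    divide-out : g ∣ c → (∀ c′ → c ≡ c′ * g → g ∣ b) → k ≡ 0
    divide-out (divides c′ c≡) g∣b with g∣b c′ c≡
    ... | divides b′ b≡ = trans k≡ (cong (_* g) (none k′ (a′ , c′ , b′ , a′⊥k′
          , divided c c′ a a′ a≡ c≡ eq₁ , divided b b′ c c′ c≡ b≡ eq₂)))

opaque
  no-ap-1 : NoAP 1
  no-ap-1 = no-ap 1 primitive-ap-1

  no-ap-2 : NoAP 2
  no-ap-2 = no-ap 2 (EvenDifference.primitive-ap-2c 1 primary-1 refl (λ d²∣1 → ∣1⇒≡1 (m*n∣⇒m∣ _ _ d²∣1)) (inj₁ refl))

  no-ap-2p : ∀ {p} → Prime p → p % 8 ≡ 5 → NoAP (2 * p)
  no-ap-2p {p} pp p%8≡5 = no-ap (2 * p) (EvenDifference.primitive-ap-2c p {{prime⇒nonZero pp}} (primary-prime pp)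
    (reduce-% p 4 (divides 2 refl) p%8≡5) squarefree (inj₂ (two-nonresidue pp p%8≡5)))
    where
    squarefree : ∀ {d} → d * d ∣ p → d ≡ 1
    squarefree {d} d²∣p with prime⇒irreducible pp (m*n∣⇒m∣ d d d²∣p)
    ... | inj₁ d≡1  = d≡1
    ... | inj₂ refl = contradiction (*-cancelˡ-∣ p {{prime⇒nonZero pp}} (subst (p * p ∣_) (sym (*-identityʳ p)) d²∣p)) (prime∤1 pp)

-- (x - y)², z², (x + y)² are in arithmetic progression with difference 2xy.
opaque
  right-triangle : ∀ D → NoAP D → ∀ k x y z → 2 * (x * y) ≡ D * (k * k) → z * z ≡ x * x + y * y → k ≡ 0
  right-triangle D no-ap k x y z area hyp =
    [ (λ x≤y → ordered x y x≤y area hyp)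
    , (λ y≤x → ordered y x y≤x (trans (cong (2 *_) (*-comm y x)) area) (trans hyp (+-comm (x * x) (y * y)))) ]′ (≤-total x y)
    where
    leg : ∀ x a → x * x + (x + a) * (x + a) ≡ a * a + 2 * (x * (x + a))
    leg = solve-∀
    sum : ∀ x y → (x + y) * (x + y) ≡ x * x + y * y + 2 * (x * y)
    sum = solve-∀
    ordered : ∀ x y → x ≤ y → 2 * (x * y) ≡ D * (k * k) → z * z ≡ x * x + y * y → k ≡ 0
    ordered x y x≤y area hyp with m≤n⇒∃[o]m+o≡n x≤y
    ... | a , refl = no-ap k a z (x + (x + a)) (trans hyp (trans (leg x a) (cong (a * a +_) area)))
          (trans (sum x (x + a)) (cong₂ _+_ (sym hyp) area))

-- Biquadratic equations

opaque
  x⁴+y⁴≢□ : ∀ x y z → z * z ≡ x * x * (x * x) + y * y * (y * y) → x * y ≡ 0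
  x⁴+y⁴≢□ x y z = right-triangle 2 no-ap-2 (x * y) (x * x) (y * y) z (area x y)
    where area : ∀ x y → 2 * (x * x * (y * y)) ≡ 2 * (x * y * (x * y))
          area = solve-∀

  x⁴+4y⁴≢□ : ∀ x y z → z * z ≡ x * x * (x * x) + 4 * (y * y * (y * y)) → x * y ≡ 0
  x⁴+4y⁴≢□ x y z eq = *-cancelˡ-≡ _ _ 2 (right-triangle 1 no-ap-1 (2 * (x * y)) (x * x) (2 * (y * y)) z (area x y) (trans eq (regroup x y)))
    where area : ∀ x y → 2 * (x * x * (2 * (y * y))) ≡ 1 * (2 * (x * y) * (2 * (x * y)))
          area = solve-∀
          regroup : ∀ x y → x * x * (x * x) + 4 * (y * y * (y * y)) ≡ x * x * (x * x) + 2 * (y * y) * (2 * (y * y))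
          regroup = solve-∀

-- If y² = x² + 2e, then (xy)², (x² + e)², z² are in arithmetic progression with difference e².
opaque
  x⁴+y⁴≡2z² : ∀ x y z → Odd x → Odd y → 2 * (z * z) ≡ x * x * (x * x) + y * y * (y * y) → x ≡ y
  x⁴+y⁴≡2z² x y z x-odd y-odd eq =
    [ (λ x≤y → ordered x y x-odd y-odd x≤y eq)
    , (λ y≤x → sym (ordered y x y-odd x-odd y≤x (trans eq (+-comm (x * x * (x * x)) _)))) ]′ (≤-total x y)
    where
    middle : ∀ x e → (x * x + e) * (x * x + e) ≡ x * x * (x * x + 2 * e) + 1 * (e * e)
    middle = solve-∀
    square : ∀ x y → x * x * (y * y) ≡ x * y * (x * y)
    square = solve-∀
    last : ∀ x e → x * x * (x * x) + (x * x + 2 * e) * (x * x + 2 * e) ≡ 2 * ((x * x + e) * (x * x + e) + 1 * (e * e))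
    last = solve-∀
    even-gap : ∀ {m o} → Odd m → Odd (m + o) → Even o
    even-gap {o = o} m-odd m+o-odd with even-or-odd o
    ... | inj₁ o-even = o-even
    ... | inj₂ o-odd  = ⊥-elim (even×odd⇒⊥ (Odd-+⇒Even m-odd o-odd) m+o-odd)
    ordered : ∀ x y → Odd x → Odd y → x ≤ y → 2 * (z * z) ≡ x * x * (x * x) + y * y * (y * y) → x ≡ y
    ordered x y x-odd y-odd x≤y eq with m≤n⇒∃[o]m+o≡n (*-mono-≤ x≤y x≤y)
    ... | o , x²+o≡y² with even-gap {x * x} {o} (Odd-* x-odd x-odd) (subst Odd (sym x²+o≡y²) (Odd-* y-odd y-odd))
    ... | e , refl = sq-injective (trans (sym (+-identityʳ (x * x))) (trans (cong (λ w → x * x + 2 * w) (sym e≡0)) x²+o≡y²))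
      where
      e≡0 : e ≡ 0
      e≡0 = no-ap-1 e (x * y) (x * x + e) z
        (trans (middle x e) (cong (_+ 1 * (e * e)) (trans (cong (x * x *_) x²+o≡y²) (square x y))))
        (*-cancelˡ-≡ _ _ 2 (trans eq (trans (cong (λ w → x * x * (x * x) + w * w) (sym x²+o≡y²)) (last x e))))

opaque
  -- Modulo 4, t = 2r. Splitting z² - s⁴ = 32r⁴ gives u⁴ = s² + 8v⁴ with r = v u; splitting u⁴ - s²
  -- = 8v⁴ gives u² = b⁴ + 2a⁴ with v = a b. This is the same equation for a, and t = 2 a (b u).
  x⁴+2y⁴≢□ : ∀ t s z → Coprime s t → z * z ≡ s * s * (s * s) + 2 * (t * t * (t * t)) → t ≡ 0
  x⁴+2y⁴≢□ t s z s⊥t eq = descent Solution step t (s , z , s⊥t , eq)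
    where
    Solution : ℕ → Set
    Solution t = ∃₂ λ s z → Coprime s t × z * z ≡ s * s * (s * s) + 2 * (t * t * (t * t))
    inner : ∀ {r u v} a b w y → Coprime w y → w + y ≡ u * u → w ≡ 2 * (a * a * (a * a)) → y ≡ b * b * (b * b) → v ≡ a * b →
            r ≡ v * u → ∃₂ λ f r′ → 2 * r ≡ 2 * (f * r′) × Solution f
    inner {u = u} a b _ _ w⊥y w+y≡ refl refl refl refl = a , b * u , cong (2 *_) (*-assoc a b u) , b , u
      , coprime-∣ (∣m⇒∣m*n (b * b) (m∣m*n b)) (∣n⇒∣m*n 2 (∣m⇒∣m*n (a * a) (m∣m*n a))) (coprime-sym w⊥y)
      , trans (sym w+y≡) (+-comm (2 * (a * a * (a * a))) _)
    step : ∀ t → Solution t → ∃₂ λ f r → t ≡ 2 * (f * r) × Solution f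
    step t (s , z , s⊥t , eq) with even-or-odd t
    ... | inj₂ (j , refl) = ⊥-elim (insoluble 4
      ((v₀ ⊗ v₀ , v₁ ⊗ v₁ ⊗ (v₁ ⊗ v₁) ⊕ con 2 ⊗ ((con 1 ⊕ con 2 ⊗ v₂) ⊗ (con 1 ⊕ con 2 ⊗ v₂) ⊗ ((con 1 ⊕ con 2 ⊗ v₂) ⊗ (con 1 ⊕ con 2 ⊗ v₂)))) ∷ [])
      _ (z ∷ s ∷ j ∷ []) (cong (_% 4) eq ∷ []))
    ... | inj₁ (r , refl) = outer s-odd (square-gap {b = z} (8 * (r * r * (r * r))) (Odd-* s-odd s-odd) (trans eq (quarter s r)))
      where
      s-odd : Odd s
      s-odd = coprime-even⇒odd (r , refl) (coprime-sym s⊥t)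
      quarter : ∀ s r → s * s * (s * s) + 2 * (2 * r * (2 * r) * (2 * r * (2 * r))) ≡ s * s * (s * s) + 4 * (8 * (r * r * (r * r)))
      quarter = solve-∀
      double : ∀ r → 2 * (8 * (r * r * (r * r))) ≡ 2 * r * (2 * r) * (2 * r * (2 * r))
      double = solve-∀
      s²⊥8r⁴ : Coprime (s * s) (8 * (r * r * (r * r)))
      s²⊥8r⁴ = coprime-∣ʳ (subst (8 * (r * r * (r * r)) ∣_) (double r) (∣n⇒∣m*n 2 ∣-refl)) (coprime-²ʳ (coprime-² s⊥t))
      primary-2 : Primary 2
      primary-2 = primary-prime prime[2]
      half : ∀ v → 8 * v ≡ 4 * (2 * v)
      half = solve-∀
      middle : ∀ u v x → r ≡ v * u → x ≡ 8 * (v * v * (v * v)) → x + s * s ≡ u * u * (u * u) →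
               ∃₂ λ f r′ → 2 * r ≡ 2 * (f * r′) × Solution f
      middle u v _ r≡ refl eq with square-gap {s} {u * u} (2 * (v * v * (v * v))) s-odd
        (trans (sym eq) (trans (+-comm (8 * (v * v * (v * v))) (s * s)) (cong (s * s +_) (half (v * v * (v * v))))))
      ... | w , w+≡ , w*≡ = [ (λ (a , b , w≡ , y≡ , v≡) → inner {r} {u} {v} a b w (w + s) w⊥y (sym w+≡) w≡ y≡ v≡ r≡)
                            , (λ (b , a , w≡ , y≡ , v≡) → inner {r} {u} {v} a b (w + s) w (coprime-sym w⊥y)
                                (trans (+-comm (w + s) w) (sym w+≡)) y≡ w≡ (trans v≡ (*-comm b a)) r≡) ]′
                            (primary-fourth {2} primary-2 w (w + s) v w⊥y w*≡)
        where
        v∣r : v ∣ r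
        v∣r = subst (v ∣_) (sym r≡) (m∣m*n u)
        w∣8r⁴ : w ∣ 8 * (r * r * (r * r))
        w∣8r⁴ = ∣-trans (subst (w ∣_) w*≡ (m∣m*n (w + s))) (*-pres-∣ {o = 2} {m = 8} (divides 4 refl) (*-pres-∣ (*-pres-∣ v∣r v∣r) (*-pres-∣ v∣r v∣r)))
        w⊥y : Coprime w (w + s)
        w⊥y = coprime-+ˡ ∣-refl (coprime-sym (coprime-∣ (m∣m*n s) w∣8r⁴ s²⊥8r⁴))
      outer : Odd s → (∃ λ x → z ≡ x + (x + s * s) × x * (x + s * s) ≡ 8 * (r * r * (r * r))) →
              ∃₂ λ f r′ → 2 * r ≡ 2 * (f * r′) × Solution f
      outer (i , refl) (x , _ , x*≡) =
        [ (λ (v , u , x≡ , y≡ , r≡) → middle u v x r≡ x≡ y≡)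
        -- The other distribution, u⁴ + s² = 8v⁴ with s odd, fails modulo 4.
        , (λ (u , v , x≡ , y≡ , _) → ⊥-elim (insoluble 4
            ((v₀ ⊗ v₀ ⊗ (v₀ ⊗ v₀) ⊕ (con 1 ⊕ con 2 ⊗ v₁) ⊗ (con 1 ⊕ con 2 ⊗ v₁) , con 8 ⊗ (v₂ ⊗ v₂ ⊗ (v₂ ⊗ v₂))) ∷ [])
            _ (u ∷ i ∷ v ∷ []) (cong (_% 4) (trans (cong (_+ s * s) (sym x≡)) y≡) ∷ []))) ]′
        (primary-fourth {8} (primary-cube {2} primary-2) x (x + s * s) r x⊥y x*≡)
        where
        x⊥y : Coprime x (x + s * s)
        x⊥y = coprime-+ˡ ∣-refl (coprime-sym (coprime-∣ʳ (subst (x ∣_) x*≡ (m∣m*n (x + s * s))) s²⊥8r⁴))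

opaque
  split-4 : ∀ a b c → Coprime a b → a * b ≡ 4 * c → (∃ λ a′ → a ≡ 4 * a′ × a′ * b ≡ c) ⊎ (∃ λ b′ → b ≡ 4 * b′ × a * b′ ≡ c)
  split-4 = primary-split (primary-² (primary-prime prime[2]))

-- In use q is p or p³. It is kept as a multiple of p because the nonresidue arguments are modulo p,
-- whereas the coprime splittings move q as one block.
module _ {p q₀ : ℕ} (nr : TwoNonresidue p) .{{_ : NonZero (p * q₀)}} (primary-q : Primary (p * q₀))
  (q%16≡13 : p * q₀ % 16 ≡ 13) where

  private
    q : ℕ
    q = p * q₀

    Solution : ℕ → Set
    Solution t = ∃₂ λ s z → Odd s × Coprime s (q * t) × z * z ≡ s * s * (s * s) + 4 * (q * (t * t * (t * t)))

    mod-16 : ∀ x y → (x + q * y) % 16 ≡ (x + 13 * y) % 16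
    mod-16 = %-coefficient 16 q q%16≡13

    opaque
      -- Splitting v² - 4a⁴ gives 4a² + q c⁴ = d⁴; splitting d⁴ - 4a² gives coprime factors q x⁴ and
      -- y⁴ with sum 2d², against 2 being a nonresidue modulo p.
      no-twist : ∀ a b v → Coprime (4 * (a * a * (a * a))) (q * (b * b * (b * b))) →
                 v * v ≢ 4 * (a * a * (a * a)) + q * (b * b * (b * b))
      no-twist a b v 4a⁴⊥qb⁴ eq = outer
        (m≤n⇒∃[o]m+o≡n (sq-cancel-≤ {2 * (a * a)} {v} (subst (2 * (a * a) * (2 * (a * a)) ≤_)
          (trans (cong (_+ q * (b * b * (b * b))) (regroup a)) (sym eq)) (m≤m+n _ _))))
        where
        regroup : ∀ a → 2 * (a * a) * (2 * (a * a)) ≡ 4 * (a * a * (a * a))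
        regroup = solve-∀
        gap : ∀ a e → 4 * (a * a * (a * a)) + e * (e + 4 * (a * a)) ≡ (2 * (a * a) + e) * (2 * (a * a) + e)
        gap = solve-∀
        gap′ : ∀ a e → 2 * a * (2 * a) + e * (e + 4 * a) ≡ (2 * a + e) * (2 * a + e)
        gap′ = solve-∀
        four : ∀ a → 4 * (a * a) ≡ 2 * a * (2 * a)
        four = solve-∀
        sum : ∀ a e → 2 * (2 * a + e) ≡ e + (e + 4 * a)
        sum = solve-∀
        b-odd : Odd b
        b-odd = Odd-*⁻ˡ b b (Odd-*⁻ˡ (b * b) (b * b) (odd-coprime
          (coprime-∣ {4 * (a * a * (a * a))} {2} (divides (2 * (a * a * (a * a))) (half (a * a * (a * a)))) (n∣m*n q) 4a⁴⊥qb⁴)))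
          where half : ∀ x → 4 * x ≡ 2 * x * 2
                half = solve-∀
        4a⊥qb⁴ : Coprime (4 * a) (q * (b * b * (b * b)))
        4a⊥qb⁴ = coprime-∣ˡ {4 * (a * a * (a * a))} {4 * a} (*-pres-∣ {o = 4} {p = a} ∣-refl (∣m⇒∣m*n (a * a) (m∣m*n a))) 4a⁴⊥qb⁴
        nonresidue : ∀ d e f x y → Coprime x y → x + y ≡ 2 * (d * d) → x ≡ q * (e * e * (e * e)) → y ≡ f * f * (f * f) → ⊥
        nonresidue d e f _ _ x⊥y x+y≡ refl refl = TwoNonresidue.2y²≢x² nr (f * f) d (q₀ * (e * e * (e * e)))
          (coprime-∣ (∣m⇒∣m*n _ (m∣m*n q₀)) (m∣m*n (f * f)) x⊥y)
          (trans (sym x+y≡) (trans (+-comm (q * (e * e * (e * e))) _) (cong (f * f * (f * f) +_) (*-assoc p q₀ _))))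
        inner : ∀ c d → c ∣ b → 4 * (a * a) + q * (c * c * (c * c)) ≡ d * d * (d * d) →
                (∃ λ e → 2 * a + e ≡ d * d) → ⊥
        inner c d c∣b eq (e , 2a+e≡d²) =
          [ (λ (x , y , e≡ , f≡ , _) → nonresidue d x y e (e + 4 * a) e⊥ e+≡ e≡ f≡)
          , (λ (y , x , e≡ , f≡ , _) → nonresidue d x y (e + 4 * a) e (coprime-sym e⊥) (trans (+-comm (e + 4 * a) e) e+≡) f≡ e≡) ]′
          (primary-fourth {q} primary-q e (e + 4 * a) c e⊥ e*≡)
          where
          e+≡ : e + (e + 4 * a) ≡ 2 * (d * d)
          e+≡ = trans (sym (sum a e)) (cong (2 *_) 2a+e≡d²)
          e*≡ : e * (e + 4 * a) ≡ q * (c * c * (c * c))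
          e*≡ = +-cancelˡ-≡ (2 * a * (2 * a)) _ _ (trans (gap′ a e)
            (trans (cong (λ w → w * w) 2a+e≡d²) (trans (sym eq) (cong (_+ q * (c * c * (c * c))) (four a)))))
          e∣qb⁴ : e ∣ q * (b * b * (b * b))
          e∣qb⁴ = ∣-trans (subst (e ∣_) e*≡ (m∣m*n (e + 4 * a)))
            (*-monoʳ-∣ q (*-pres-∣ (*-pres-∣ c∣b c∣b) (*-pres-∣ c∣b c∣b)))
          e⊥ : Coprime e (e + 4 * a)
          e⊥ = coprime-+ˡ ∣-refl (coprime-∣ˡ e∣qb⁴ (coprime-sym 4a⊥qb⁴))
        outer : (∃ λ e → 2 * (a * a) + e ≡ v) → ⊥
        outer (e , refl) =
          [ (λ (c , d , e≡ , f≡ , b≡) → inner c d (subst (c ∣_) (sym b≡) (m∣m*n d))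
               (trans (+-comm (4 * (a * a)) _) (trans (cong (_+ 4 * (a * a)) (sym e≡)) f≡))
               (m≤n⇒∃[o]m+o≡n (sq-cancel-≤ {2 * a} {d * d} (subst₂ _≤_ (four a) f≡ (m≤n+m (4 * (a * a)) e)))))
          , (λ (c , d , e≡ , f≡ , b≡) → mod c d (Odd-*⁻ˡ c d (subst Odd b≡ b-odd)) (Odd-*⁻ˡ d c (subst Odd (trans b≡ (*-comm c d)) b-odd))
               (trans (cong (_+ 4 * (a * a)) (sym e≡)) f≡)) ]′
          (primary-fourth {q} primary-q e (e + 4 * (a * a)) b e⊥ e*≡)
          where
          e*≡ : e * (e + 4 * (a * a)) ≡ q * (b * b * (b * b))
          e*≡ = +-cancelˡ-≡ (4 * (a * a * (a * a))) _ _ (trans (gap a e) eq)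
          e⊥ : Coprime e (e + 4 * (a * a))
          e⊥ = coprime-+ˡ ∣-refl (coprime-sym (coprime-∣ {4 * (a * a * (a * a))} {4 * (a * a)} (*-pres-∣ {o = 4} {p = a * a} ∣-refl (m∣m*n (a * a)))
                 (subst (e ∣_) e*≡ (m∣m*n (e + 4 * (a * a)))) 4a⁴⊥qb⁴))
          -- For odd c and d this reads 1 + 4a² ≡ 13 modulo 16, that is a² ≡ 3 modulo 4.
          mod : ∀ c d → Odd c → Odd d → c * c * (c * c) + 4 * (a * a) ≢ q * (d * d * (d * d))
          mod c d (i , refl) (j , refl) eq = insoluble 16
            ((fourth (odd zero) ⊕ con 4 ⊗ (v₂ ⊗ v₂) , con 13 ⊗ fourth (odd (suc zero))) ∷ [])
            _ (i ∷ j ∷ a ∷ []) (trans (cong (_% 16) eq) (mod-16 0 (d * d * (d * d))) ∷ [])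

    opaque
      -- The coprime numbers e and x have product q w⁴. If q lies in e, then v² = b⁴ + 4 q a⁴ is the
      -- smaller solution; if it lies in x, the equation is the one refuted by `no-twist`.
      descend-summand : ∀ w u v e x → Coprime (4 * e) x → 4 * e + x ≡ v * v → e * x ≡ q * (w * w * (w * w)) → u ≡ 2 * w →
              ∃₂ λ f r → u * v ≡ 2 * (f * r) × Solution f
      descend-summand w u v e x 4e⊥x v²≡ ex≡ refl =
        [ (λ (a , b , e≡ , x≡ , w≡) → descend a b e≡ x≡ w≡)
        , (λ (a , b , e≡ , x≡ , _) → ⊥-elim (no-twist a b v
             (subst₂ (λ e x → Coprime (4 * e) x) e≡ x≡ 4e⊥x) (trans (sym v²≡) (cong₂ (λ e x → 4 * e + x) e≡ x≡)))) ]′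
        (primary-fourth {q} primary-q e x w (coprime-∣ˡ (n∣m*n 4) 4e⊥x) ex≡)
        where
        descend : ∀ a b → e ≡ q * (a * a * (a * a)) → x ≡ b * b * (b * b) → w ≡ a * b →
                  ∃₂ λ f r → 2 * w * v ≡ 2 * (f * r) × Solution f
        descend a b refl refl refl = a , b * v , regroup a b v , b , v
          , Odd-*⁻ˡ b b (Odd-*⁻ˡ (b * b) (b * b) (odd-coprime (coprime-∣ˡ {4 * e} {2} (divides (2 * e) (half e)) 4e⊥x)))
          , coprime-∣ {x} {b} {4 * e} {q * a} (∣m⇒∣m*n (b * b) (m∣m*n b)) (∣n⇒∣m*n 4 (*-monoʳ-∣ q (∣m⇒∣m*n (a * a) (m∣m*n a)))) (coprime-sym 4e⊥x)
          , trans (sym v²≡) (+-comm (4 * e) x)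
          where regroup : ∀ a b v → 2 * (a * b) * v ≡ 2 * (a * (b * v))
                regroup = solve-∀
                half : ∀ e → 4 * e ≡ 2 * e * 2
                half = solve-∀

    opaque
      -- The difference v⁴ - s² splits into the coprime numbers x and x + s with sum v² and product
      -- 4 q w⁴, and one of them takes the whole factor 4.
      descend-root : ∀ s u v w → Odd s → Coprime s (4 * (q * (w * w * (w * w)))) → u ≡ 2 * w →
                     v * v * (v * v) ≡ s * s + 4 * (4 * (q * (w * w * (w * w)))) →
                     ∃₂ λ f r → u * v ≡ 2 * (f * r) × Solution f
      descend-root s u v w s-odd s⊥ u≡2w eq = go (square-gap {s} {v * v} (4 * (q * (w * w * (w * w)))) s-odd eq)
        where
        go : (∃ λ x → v * v ≡ x + (x + s) × x * (x + s) ≡ 4 * (q * (w * w * (w * w)))) →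
             ∃₂ λ f r → u * v ≡ 2 * (f * r) × Solution f
        go (x , v²≡ , x*≡) = cases (split-4 x (x + s) (q * (w * w * (w * w))) x⊥ x*≡)
          where
          x⊥ : Coprime x (x + s)
          x⊥ = coprime-+ˡ ∣-refl (coprime-sym (coprime-∣ʳ (subst (x ∣_) x*≡ (m∣m*n (x + s))) s⊥))
          cases : (∃ λ e → x ≡ 4 * e × e * (x + s) ≡ q * (w * w * (w * w))) ⊎ (∃ λ e → x + s ≡ 4 * e × x * e ≡ q * (w * w * (w * w))) →
                  ∃₂ λ f r → u * v ≡ 2 * (f * r) × Solution f
          cases (inj₁ (e , x≡ , e*≡)) = descend-summand w u v e (x + s) (subst (λ x′ → Coprime x′ (x + s)) x≡ x⊥)
            (trans (cong (_+ (x + s)) (sym x≡)) (sym v²≡)) e*≡ u≡2w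
          cases (inj₂ (e , y≡ , *e≡)) = descend-summand w u v e x (subst (λ y → Coprime y x) y≡ (coprime-sym x⊥))
            (trans (cong (_+ x) (sym y≡)) (trans (+-comm (x + s) x) (sym v²≡))) (trans (*-comm e x) *e≡) u≡2w

  opaque
    -- Splitting z² - s⁴ puts q on one of two fourth powers. Modulo 16 only s² + q u⁴ = v⁴ with u
    -- even survives, because s² is 1 or 9 and fourth powers are 0 or 1.
    x⁴+4qy⁴≢□ : ∀ t s z → Odd s → Coprime s (q * t) → z * z ≡ s * s * (s * s) + 4 * (q * (t * t * (t * t))) → t ≡ 0
    x⁴+4qy⁴≢□ t s z s-odd s⊥qt eq = descent Solution step t (s , z , s-odd , s⊥qt , eq)
      where
      step : ∀ t → Solution t → ∃₂ λ f r → t ≡ 2 * (f * r) × Solution f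
      step t (s , z , s-odd , s⊥qt , eq) = outer (square-gap {b = z} (q * (t * t * (t * t))) (Odd-* s-odd s-odd) eq)
        where
        s⊥qt⁴ : Coprime s (q * (t * t * (t * t)))
        s⊥qt⁴ = coprime-*ʳ {b = q} (coprime-∣ʳ {b′ = q} (m∣m*n t) s⊥qt) (coprime-²ʳ (coprime-²ʳ (coprime-∣ʳ (n∣m*n q) s⊥qt)))
        impossible : ∀ u v → Odd s → u * u * (u * u) + s * s ≢ q * (v * v * (v * v))
        impossible u v (i , refl) eq = insoluble 16
          ((fourth v₀ ⊕ odd (suc zero) ⊗ odd (suc zero) , con 13 ⊗ fourth v₂) ∷ [])
          _ (u ∷ i ∷ v ∷ []) (trans (cong (_% 16) eq) (mod-16 0 (v * v * (v * v))) ∷ [])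
        even : ∀ u v → Odd s → s * s + q * (u * u * (u * u)) ≡ v * v * (v * v) → Even u
        even u v (i , refl) eq with even-or-odd u
        ... | inj₁ u-even = u-even
        ... | inj₂ (j , refl) = ⊥-elim (insoluble 16
          ((odd zero ⊗ odd zero ⊕ con 13 ⊗ fourth (odd (suc zero)) , fourth v₂) ∷ [])
          _ (i ∷ j ∷ v ∷ []) (trans (sym (mod-16 (s * s) (u * u * (u * u)))) (cong (_% 16) eq) ∷ []))
        middle : ∀ u v w → u ∣ t → u ≡ 2 * w → s * s + q * (u * u * (u * u)) ≡ v * v * (v * v) →
                 ∃₂ λ f r → u * v ≡ 2 * (f * r) × Solution f
        middle u v w u∣t u≡2w eq = descend-root s u v w s-odd s⊥4qw⁴ u≡2w
          (trans (sym eq) (cong (s * s +_) (trans (cong (λ u → q * (u * u * (u * u))) u≡2w) (sixteen q w))))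
          where
          sixteen : ∀ q w → q * (2 * w * (2 * w) * (2 * w * (2 * w))) ≡ 4 * (4 * (q * (w * w * (w * w))))
          sixteen = solve-∀
          w∣t : w ∣ t
          w∣t = ∣-trans (subst (w ∣_) (sym u≡2w) (n∣m*n 2)) u∣t
          s⊥4qw⁴ : Coprime s (4 * (q * (w * w * (w * w))))
          s⊥4qw⁴ = coprime-*ʳ {b = 4} {c = q * (w * w * (w * w))} (coprime-²ʳ {s} {2} (coprime-sym (coprime-odd s-odd)))
            (coprime-∣ʳ (*-monoʳ-∣ q (*-pres-∣ (*-pres-∣ w∣t w∣t) (*-pres-∣ w∣t w∣t))) s⊥qt⁴)
        outer : (∃ λ x → z ≡ x + (x + s * s) × x * (x + s * s) ≡ q * (t * t * (t * t))) →
                ∃₂ λ f r → t ≡ 2 * (f * r) × Solution f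
        outer (x , _ , x*≡) =
          [ (λ (u , v , x≡ , y≡ , t≡) → finish u v t≡
               (trans (cong (s * s +_) (sym x≡)) (trans (+-comm (s * s) x) y≡)))
          , (λ (u , v , x≡ , y≡ , _) → ⊥-elim (impossible u v s-odd (trans (cong (_+ s * s) (sym x≡)) y≡))) ]′
          (primary-fourth {q} primary-q x (x + s * s) t x⊥ x*≡)
          where
          x⊥ : Coprime x (x + s * s)
          x⊥ = coprime-+ˡ ∣-refl (coprime-∣ˡ (subst (x ∣_) x*≡ (m∣m*n (x + s * s))) (coprime-sym (coprime-²ˡ s⊥qt⁴)))
          finish : ∀ u v → t ≡ u * v → s * s + q * (u * u * (u * u)) ≡ v * v * (v * v) → ∃₂ λ f r → t ≡ 2 * (f * r) × Solution f
          finish u v t≡uv eq with even u v s-odd eq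
          ... | w , u≡2w with middle u v w (subst (u ∣_) (sym t≡uv) (m∣m*n v)) u≡2w eq
          ...   | f , r , uv≡ , sol = f , r , trans t≡uv uv≡ , sol

-- The four curves in integral form

opaque
  prime-square-∣ : ∀ {p a} → Prime p → IsSquare (p * a) → p ∣ a
  prime-square-∣ {p} {a} pp (r , eq) = *-cancelˡ-∣ p {{prime⇒nonZero pp}}
    (subst (p * p ∣_) (sym eq) (*-pres-∣ p∣r p∣r))
    where
    p∣r : p ∣ r
    p∣r = prime-∣² {n = r} pp (subst (p ∣_) eq (m∣m*n a))

  half-square : ∀ {p a} → Prime p → IsSquare (p * a) → ∃ λ z → a ≡ p * (z * z)
  half-square {p} {a} pp (r , eq) with prime-∣² {n = r} pp (subst (p ∣_) eq (m∣m*n a))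
  ... | divides z refl = z , *-cancelˡ-≡ _ _ p {{prime⇒nonZero pp}} (trans eq (regroup z p))
    where regroup : ∀ z p → z * p * (z * p) ≡ p * (p * (z * z))
          regroup = solve-∀

  -- Here a b is p times a square, and p goes whole to one of the coprime factors, which leaves the
  -- other a square.
  square-class : ∀ {p a b} → Prime p → Coprime a b → IsSquare (p * (a * b)) →
                 (IsSquare a × IsSquare (p * b)) ⊎ (IsSquare (p * a) × IsSquare b)
  square-class {p} {a} {b} pp a⊥b sq with half-square pp sq
  ... | z , eq = [ (λ (u , v , a≡ , b≡ , _) → inj₂ (scaled u a≡ , v , b≡))
                 , (λ (u , v , a≡ , b≡ , _) → inj₁ ((u , a≡) , scaled v b≡)) ]′
                 (primary-square {{prime⇒nonZero pp}} (primary-prime pp) a b z a⊥b eq)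
    where
    regroup : ∀ p u → p * (p * (u * u)) ≡ p * u * (p * u)
    regroup = solve-∀
    scaled : ∀ {a} u → a ≡ p * (u * u) → IsSquare (p * a)
    scaled u a≡ = p * u , trans (cong (p *_) a≡) (regroup p u)

opaque
  coprime-sums : ∀ x d → Coprime x d → Coprime (x + d) (x + 2 * d)
  coprime-sums x d x⊥d = subst (Coprime (x + d)) (regroup x d)
    (coprime-+ˡ ∣-refl (coprime-sym (coprime-+ʳ ∣-refl (coprime-sym x⊥d))))
    where regroup : ∀ x d → x + d + d ≡ x + 2 * d
          regroup = solve-∀

  coprime-2* : ∀ {m d} → Odd m → Coprime m d → Coprime m (2 * d)
  coprime-2* {m} {d} m-odd m⊥d = coprime-*ʳ {m} {2} {d} (coprime-sym (coprime-odd m-odd)) m⊥d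

  coprime-4* : ∀ {m d} → Odd m → Coprime m d → Coprime m (4 * d)
  coprime-4* {m} {d} m-odd m⊥d = coprime-*ʳ {m} {4} {d} (coprime-²ʳ {m} {2} (coprime-sym (coprime-odd m-odd))) m⊥d

square-from : ∀ {a b c} → c ≡ a * b → Coprime a b → IsSquare c → IsSquare a × IsSquare b
square-from c≡ab a⊥b sq = square-factorˡ a⊥b (subst IsSquare c≡ab sq) , square-factorʳ a⊥b (subst IsSquare c≡ab sq)

ap-of : ∀ {D} → NoAP D → ∀ k a u v → IsSquare u → IsSquare v → u ≡ a * a + D * (k * k) → v ≡ u + D * (k * k) → k ≡ 0
ap-of {D} none k a u v (c , u≡) (b , v≡) eq₁ eq₂ =
  none k a c b (trans (sym u≡) eq₁) (trans (sym v≡) (trans eq₂ (cong (_+ D * (k * k)) u≡)))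

-- quartic-d² and quartic-4d² (with s = p t²) and quartic-4q cover p ∤ m; quartic-p, quartic-4p and
-- quartic-pm² cover p ∣ m, after cancelling even powers of p.
opaque
  quartic-d² : ∀ m s → Coprime m s → IsSquare (m * ((m * m + s * s) * (m * m + 2 * (s * s)))) → m ≡ 0 ⊎ s ≡ 0
  quartic-d² m s m⊥s sq = cases (even-or-odd m)
    where
    U V : ℕ
    U = m * m + s * s
    V = m * m + 2 * (s * s)
    swap : ∀ m u v → m * (u * v) ≡ u * (m * v)
    swap = solve-∀
    m⊥U : Coprime m U
    m⊥U = coprime-+ˡ (m∣m*n m) (coprime-²ʳ m⊥s)
    U⊥V : Coprime U V
    U⊥V = coprime-sums (m * m) (s * s) (coprime-² m⊥s)
    factors : IsSquare U × IsSquare (m * V)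
    factors = square-from (swap m U V) (coprime-*ʳ (coprime-sym m⊥U) U⊥V) sq
    cases : Even m ⊎ Odd m → m ≡ 0 ⊎ s ≡ 0
    -- All three factors are coprime, so m², U, V are squares in progression with difference s².
    cases (inj₂ m-odd) = inj₂ (ap-of {1} no-ap-1 s m U V (proj₁ factors)
      (square-factorʳ (coprime-+ˡ (m∣m*n m) (coprime-2* m-odd (coprime-²ʳ m⊥s))) (proj₂ factors))
      (cong (m * m +_) (sym (*-identityˡ (s * s)))) (step m s))
      where step : ∀ m s → m * m + 2 * (s * s) ≡ m * m + s * s + 1 * (s * s)
            step = solve-∀
    -- With m = 2k and V = 2V′ one has m V = 4 k V′, so s², V′, U are squares in progression with
    -- difference 2k².
    cases (inj₁ (k , refl)) = inj₁ (cong (2 *_) (ap-of {2} no-ap-2 k s V′ U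
      (square-factorʳ k⊥V′ (square-unscale 2 (subst IsSquare (extract k s) (proj₂ factors)))) (proj₁ factors)
      (+-comm (2 * (k * k)) (s * s)) (step k s)))
      where
      V′ : ℕ
      V′ = 2 * (k * k) + s * s
      extract : ∀ k s → 2 * k * (2 * k * (2 * k) + 2 * (s * s)) ≡ 2 * 2 * (k * (2 * (k * k) + s * s))
      extract = solve-∀
      step : ∀ k s → 2 * k * (2 * k) + s * s ≡ 2 * (k * k) + s * s + 2 * (k * k)
      step = solve-∀
      k⊥V′ : Coprime k V′
      k⊥V′ = coprime-+ˡ (∣n⇒∣m*n 2 (m∣m*n k)) (coprime-²ʳ (coprime-∣ˡ (n∣m*n 2) m⊥s))

fourth-zero : ∀ {s t} → s * t ≡ 0 → s * s ≡ 0 ⊎ t ≡ 0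
fourth-zero {s} st≡0 = [ (λ { refl → inj₁ refl }) , inj₂ ]′ (m*n≡0⇒m≡0∨n≡0 s st≡0)

opaque
  -- The factors m, U, V, with m / 2 and V / 2 for even m, are pairwise coprime; p attaches to one,
  -- and the other two are squares. U and V give a progression, m and U a sum x⁴ + y⁴ or x⁴ + 4y⁴, m
  -- and V a sum x⁴ + 2y⁴.
  quartic-p : ∀ {p} → Prime p → ∀ m t → Coprime m t →
    IsSquare (p * (m * ((m * m + t * t * (t * t)) * (m * m + 2 * (t * t * (t * t)))))) → m ≡ 0 ⊎ t ≡ 0
  quartic-p {p} pp m t m⊥t sq = cases (even-or-odd m)
    where
    τ U V : ℕ
    τ = t * t
    U = m * m + τ * τ
    V = m * m + 2 * (τ * τ)
    swap : ∀ p m u v → p * (m * (u * v)) ≡ p * (u * (m * v))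
    swap = solve-∀
    m⊥τ² : Coprime m (τ * τ)
    m⊥τ² = coprime-²ʳ (coprime-²ʳ m⊥t)
    U⊥mV : Coprime U (m * V)
    U⊥mV = coprime-*ʳ (coprime-sym (coprime-+ˡ (m∣m*n m) m⊥τ²)) (coprime-sums (m * m) (τ * τ) (coprime-²ˡ m⊥τ²))
    classes : (IsSquare U × IsSquare (p * (m * V))) ⊎ (IsSquare (p * U) × IsSquare (m * V))
    classes = square-class pp U⊥mV (subst IsSquare (swap p m U V) sq)
    cases : Even m ⊎ Odd m → m ≡ 0 ⊎ t ≡ 0
    cases (inj₂ m-odd) = [ (λ (U□ , pmV□) → [ (λ (m□ , _) → sum-of-fourths m□ U□) , (λ (_ , V□) → progression U□ V□) ]′ (square-class pp m⊥V pmV□))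
                         , (λ (_ , mV□) → inj₂ (twisted (square-factorˡ m⊥V mV□) (square-factorʳ m⊥V mV□))) ]′ classes
      where
      m⊥V : Coprime m V
      m⊥V = coprime-+ˡ (m∣m*n m) (coprime-2* m-odd m⊥τ²)
      step : ∀ m s → m * m + 2 * (s * s) ≡ m * m + s * s + 1 * (s * s)
      step = solve-∀
      sum-of-fourths : IsSquare m → IsSquare U → m ≡ 0 ⊎ t ≡ 0
      sum-of-fourths (s , refl) (z , U≡) = fourth-zero {s} (x⁴+y⁴≢□ s t z (sym U≡))
      progression : IsSquare U → IsSquare V → m ≡ 0 ⊎ t ≡ 0
      progression U□ V□ = inj₂ (sq≡0 (ap-of {1} no-ap-1 τ m U V U□ V□ (cong (m * m +_) (sym (*-identityˡ (τ * τ)))) (step m τ)))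
      twisted : IsSquare m → IsSquare V → t ≡ 0
      twisted (s , refl) (z , V≡) = x⁴+2y⁴≢□ t s z (coprime-∣ˡ (m∣m*n s) m⊥t) (sym V≡)
    cases (inj₁ (k , refl)) = [ (λ (U□ , pmV□) → [ (λ (k□ , _) → fourths k□ U□) , (λ (_ , V′□) → inj₁ (progression U□ V′□)) ]′
                                  (square-class pp k⊥V′ (square-unscale 2 (subst IsSquare (extract-p p k τ) pmV□))))
                              , (λ (_ , mV□) → inj₁ (twisted (square-unscale 2 (subst IsSquare (extract k τ) mV□)))) ]′ classes
      where
      V′ : ℕ
      V′ = 2 * (k * k) + τ * τ
      extract : ∀ k s → 2 * k * (2 * k * (2 * k) + 2 * (s * s)) ≡ 2 * 2 * (k * (2 * (k * k) + s * s))
      extract = solve-∀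
      extract-p : ∀ p k s → p * (2 * k * (2 * k * (2 * k) + 2 * (s * s))) ≡ 2 * 2 * (p * (k * (2 * (k * k) + s * s)))
      extract-p = solve-∀
      step : ∀ k s → 2 * k * (2 * k) + s * s ≡ 2 * (k * k) + s * s + 2 * (k * k)
      step = solve-∀
      fourths-eq : ∀ s t → 2 * (s * s) * (2 * (s * s)) + t * t * (t * t) ≡ t * t * (t * t) + 4 * (s * s * (s * s))
      fourths-eq = solve-∀
      k⊥t : Coprime k t
      k⊥t = coprime-∣ˡ (n∣m*n 2) m⊥t
      k⊥V′ : Coprime k V′
      k⊥V′ = coprime-+ˡ (∣n⇒∣m*n 2 (m∣m*n k)) (coprime-²ʳ (coprime-²ʳ k⊥t))
      progression : IsSquare U → IsSquare V′ → 2 * k ≡ 0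
      progression U□ V′□ = cong (2 *_) (ap-of {2} no-ap-2 k τ V′ U V′□ U□ (+-comm (2 * (k * k)) (τ * τ)) (step k τ))
      fourths : IsSquare k → IsSquare U → 2 * k ≡ 0 ⊎ t ≡ 0
      fourths (s , refl) (z , U≡) = [ inj₂ , (λ { refl → inj₁ refl }) ]′
        (m*n≡0⇒m≡0∨n≡0 t (x⁴+4y⁴≢□ t s z (trans (sym U≡) (fourths-eq s t))))
      twisted : IsSquare (k * V′) → 2 * k ≡ 0
      twisted kV′□ with square-factorˡ k⊥V′ kV′□ | square-factorʳ k⊥V′ kV′□
      ... | s , refl | z , V′≡ = cong (λ s → 2 * (s * s))
        (x⁴+2y⁴≢□ s t z (coprime-sym (coprime-∣ˡ (m∣m*n s) k⊥t)) (trans (sym V′≡) (+-comm (2 * (s * s * (s * s))) _)))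

opaque
  odd-squares-sum : ∀ {a b} → Odd a → Odd b → ¬ IsSquare (a * a + b * b)
  odd-squares-sum (i , refl) (j , refl) (r , eq) = insoluble 4
    ((odd zero ⊗ odd zero ⊕ odd (suc zero) ⊗ odd (suc zero) , v₂ ⊗ v₂) ∷ []) _ (i ∷ j ∷ r ∷ []) (cong (_% 4) eq ∷ [])

  odd-squares-sum₂ : ∀ {a b} → Odd a → Odd b → ¬ IsSquare (a * a + 2 * (b * b))
  odd-squares-sum₂ (i , refl) (j , refl) (r , eq) = insoluble 4
    ((odd zero ⊗ odd zero ⊕ con 2 ⊗ (odd (suc zero) ⊗ odd (suc zero)) , v₂ ⊗ v₂) ∷ []) _ (i ∷ j ∷ r ∷ []) (cong (_% 4) eq ∷ [])

  double-odd : ∀ {a} → Odd a → ¬ IsSquare (2 * a)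
  double-odd (i , refl) (r , eq) = insoluble 4
    ((con 2 ⊗ odd zero , v₁ ⊗ v₁) ∷ []) _ (i ∷ r ∷ []) (cong (_% 4) eq ∷ [])

opaque
  -- Odd m is `quartic-d²` with 2s for s. For m = 2n the product is 32 n u v, and modulo 4 the extra
  -- 2 leaves only even n with u and v / 2 squares: a progression with difference n² / 2.
  quartic-4d² : ∀ m s → Coprime m s → IsSquare (m * ((m * m + 4 * (s * s)) * (m * m + 8 * (s * s)))) → m ≡ 0 ⊎ s ≡ 0
  quartic-4d² m s m⊥s sq = cases (even-or-odd m)
    where
    doubled : ∀ m s → m * ((m * m + 4 * (s * s)) * (m * m + 8 * (s * s))) ≡
                      m * ((m * m + 2 * s * (2 * s)) * (m * m + 2 * (2 * s * (2 * s))))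
    doubled = solve-∀
    cases : Even m ⊎ Odd m → m ≡ 0 ⊎ s ≡ 0
    cases (inj₂ m-odd) = map₂ (*-cancelˡ-≡ s 0 2)
      (quartic-d² m (2 * s) (coprime-2* m-odd m⊥s) (subst IsSquare (doubled m s) sq))
    cases (inj₁ (n , refl)) = map₁ (cong (2 *_)) (halved (even-or-odd n)
      (square-class prime[2] (coprime-*ʳ (coprime-sym n⊥u) u⊥v) (square-unscale 4 (subst IsSquare (extract n s) sq))))
      where
      u v : ℕ
      u = n * n + s * s
      v = n * n + 2 * (s * s)
      s-odd : Odd s
      s-odd = coprime-even⇒odd (n , refl) m⊥s
      n⊥s : Coprime n s
      n⊥s = coprime-∣ˡ (n∣m*n 2) m⊥s
      n⊥u : Coprime n u
      n⊥u = coprime-+ˡ (m∣m*n n) (coprime-²ʳ n⊥s)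
      u⊥v : Coprime u v
      u⊥v = coprime-sums (n * n) (s * s) (coprime-² n⊥s)
      extract : ∀ n s → 2 * n * ((2 * n * (2 * n) + 4 * (s * s)) * (2 * n * (2 * n) + 8 * (s * s))) ≡
                        4 * 4 * (2 * ((n * n + s * s) * (n * (n * n + 2 * (s * s)))))
      extract = solve-∀
      halved : Even n ⊎ Odd n → (IsSquare u × IsSquare (2 * (n * v))) ⊎ (IsSquare (2 * u) × IsSquare (n * v)) → n ≡ 0 ⊎ s ≡ 0
      halved (inj₂ n-odd) (inj₁ (u□ , _)) = ⊥-elim (odd-squares-sum n-odd s-odd u□)
      halved (inj₂ n-odd) (inj₂ (_ , nv□)) = ⊥-elim (odd-squares-sum₂ n-odd s-odd
        (square-factorʳ (coprime-+ˡ (m∣m*n n) (coprime-2* n-odd (coprime-²ʳ n⊥s))) nv□))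
      halved (inj₁ (k , refl)) (inj₂ (2u□ , _)) = ⊥-elim (double-odd (odd-coprime
        (coprime-+ˡ (∣m⇒∣m*n (2 * k) (m∣m*n k)) (coprime-odd (Odd-* s-odd s-odd)))) 2u□)
      halved (inj₁ (k , refl)) (inj₁ (u□ , 2nv□)) = inj₁ (cong (2 *_) (ap-of {2} no-ap-2 k s v′ u
        (square-factorʳ 2k⊥v′ (square-unscale 2 (subst IsSquare (extract′ k s) 2nv□))) u□
        (+-comm (2 * (k * k)) (s * s)) (step k s)))
        where
        v′ : ℕ
        v′ = 2 * (k * k) + s * s
        extract′ : ∀ k s → 2 * (2 * k * (2 * k * (2 * k) + 2 * (s * s))) ≡ 2 * 2 * (2 * k * (2 * (k * k) + s * s))
        extract′ = solve-∀
        step : ∀ k s → 2 * k * (2 * k) + s * s ≡ 2 * (k * k) + s * s + 2 * (k * k)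
        step = solve-∀
        2k⊥v′ : Coprime (2 * k) v′
        2k⊥v′ = coprime-+ˡ (*-pres-∣ {o = 2} {m = 2} {p = k} ∣-refl (m∣m*n k)) (coprime-²ʳ n⊥s)

opaque
  -- As -1 is a nonresidue and p is prime to 2t, p cannot divide the sums of two squares U and u. A
  -- solution survives only for odd n = m / 2, where n = s² and u = 2z² give s⁴ + t⁴ = 2z².
  quartic-4p : ∀ {p} → Prime p → p % 4 ≡ 3 → ∀ m t → Coprime m t → Coprime p t →
    IsSquare (p * (m * ((m * m + 4 * (t * t * (t * t))) * (m * m + 8 * (t * t * (t * t)))))) →
    m ≡ 0 ⊎ t ≡ 0 ⊎ (p ≡ 3 × m ≡ 2 × t ≡ 1)
  quartic-4p {p} pp p%4≡3 m t m⊥t p⊥t sq = cases (even-or-odd m)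
    where
    τ U V : ℕ
    τ = t * t
    U = m * m + 4 * (τ * τ)
    V = m * m + 8 * (τ * τ)
    p-odd : Odd p
    p-odd = odd-if (reduce-% p 2 (divides 2 refl) p%4≡3)
    p∤norm : ∀ x y → Coprime p x → ¬ p ∣ x * x + 1 * (y * y)
    p∤norm = prime-∤-norm 1 pp (-1-nonresidue p p%4≡3)
    cases : Even m ⊎ Odd m → m ≡ 0 ⊎ t ≡ 0 ⊎ (p ≡ 3 × m ≡ 2 × t ≡ 1)
    cases (inj₂ m-odd) = classes (square-class pp U⊥mV (subst IsSquare (swap p m U V) sq))
      where
      swap : ∀ p m u v → p * (m * (u * v)) ≡ p * (u * (m * v))
      swap = solve-∀
      norm : ∀ m τ → m * m + 4 * (τ * τ) ≡ 2 * τ * (2 * τ) + 1 * (m * m)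
      norm = solve-∀
      sums : ∀ m τ → m * m + 2 * (4 * (τ * τ)) ≡ m * m + 8 * (τ * τ)
      sums = solve-∀
      eq₁ : ∀ m τ → m * m + 4 * (τ * τ) ≡ m * m + 1 * (2 * τ * (2 * τ))
      eq₁ = solve-∀
      eq₂ : ∀ m τ → m * m + 8 * (τ * τ) ≡ m * m + 4 * (τ * τ) + 1 * (2 * τ * (2 * τ))
      eq₂ = solve-∀
      m⊥4τ² : Coprime m (4 * (τ * τ))
      m⊥4τ² = coprime-4* m-odd (coprime-²ʳ (coprime-²ʳ m⊥t))
      m⊥V : Coprime m V
      m⊥V = subst (Coprime m) (sums m τ) (coprime-+ˡ (m∣m*n m) (coprime-2* m-odd m⊥4τ²))
      U⊥mV : Coprime U (m * V)
      U⊥mV = coprime-*ʳ (coprime-sym (coprime-+ˡ (m∣m*n m) m⊥4τ²))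
        (subst (Coprime U) (sums m τ) (coprime-sums (m * m) (4 * (τ * τ)) (coprime-²ˡ m⊥4τ²)))
      p∤U : ¬ p ∣ U
      p∤U p∣U = p∤norm (2 * τ) m (coprime-2* p-odd (coprime-²ʳ p⊥t)) (subst (p ∣_) (norm m τ) p∣U)
      fourths : IsSquare m → IsSquare U → m ≡ 0 ⊎ t ≡ 0 ⊎ (p ≡ 3 × m ≡ 2 × t ≡ 1)
      fourths (s , refl) (z , U≡) = map₂ inj₁ (fourth-zero {s} (x⁴+4y⁴≢□ s t z (sym U≡)))
      progression : IsSquare U → IsSquare V → t ≡ 0
      progression U□ V□ = sq≡0 (*-cancelˡ-≡ τ 0 2
        (ap-of {1} no-ap-1 (2 * τ) m U V U□ V□ (eq₁ m τ) (eq₂ m τ)))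
      classes : (IsSquare U × IsSquare (p * (m * V))) ⊎ (IsSquare (p * U) × IsSquare (m * V)) →
                m ≡ 0 ⊎ t ≡ 0 ⊎ (p ≡ 3 × m ≡ 2 × t ≡ 1)
      classes (inj₂ (pU□ , _)) = contradiction (prime-square-∣ pp pU□) p∤U
      classes (inj₁ (U□ , pmV□)) = [ (λ (m□ , _) → fourths m□ U□) , (λ (_ , V□) → inj₂ (inj₁ (progression U□ V□))) ]′
        (square-class pp m⊥V pmV□)
    cases (inj₁ (n , refl)) = halved (even-or-odd n)
      where
      u v : ℕ
      u = n * n + τ * τ
      v = n * n + 2 * (τ * τ)
      t-odd : Odd t
      t-odd = coprime-even⇒odd (n , refl) m⊥t
      τ-odd : Odd τ
      τ-odd = Odd-* t-odd t-odd
      n⊥t : Coprime n t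
      n⊥t = coprime-∣ˡ (n∣m*n 2) m⊥t
      n⊥τ : Coprime n τ
      n⊥τ = coprime-²ʳ n⊥t
      n⊥u : Coprime n u
      n⊥u = coprime-+ˡ (m∣m*n n) (coprime-²ʳ n⊥τ)
      u⊥v : Coprime u v
      u⊥v = coprime-sums (n * n) (τ * τ) (coprime-² n⊥τ)
      p⊥u : Coprime p u
      p⊥u with prime-coprime-or-∣ pp u
      ... | inj₁ p⊥u = p⊥u
      ... | inj₂ p∣u = contradiction (subst (p ∣_) (norm n τ) p∣u) (p∤norm τ n (coprime-²ʳ p⊥t))
        where norm : ∀ n τ → n * n + τ * τ ≡ τ * τ + 1 * (n * n)
              norm = solve-∀
      halved : Even n ⊎ Odd n → 2 * n ≡ 0 ⊎ t ≡ 0 ⊎ (p ≡ 3 × 2 * n ≡ 2 × t ≡ 1)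
      halved (inj₂ n-odd) = classes (square-class pp v⊥n2u (square-unscale 4 (subst IsSquare (extract p n τ) sq)))
        where
        extract : ∀ p n τ → p * (2 * n * ((2 * n * (2 * n) + 4 * (τ * τ)) * (2 * n * (2 * n) + 8 * (τ * τ)))) ≡
                  4 * 4 * (p * ((n * n + 2 * (τ * τ)) * (n * (2 * (n * n + τ * τ)))))
        extract = solve-∀
        n⊥v : Coprime n v
        n⊥v = coprime-+ˡ (m∣m*n n) (coprime-2* n-odd (coprime-²ʳ n⊥τ))
        2⊥v : Coprime 2 v
        2⊥v = coprime-+ʳ (m∣m*n (τ * τ)) (coprime-odd (Odd-* n-odd n-odd))
        v⊥n2u : Coprime v (n * (2 * u))
        v⊥n2u = coprime-*ʳ (coprime-sym n⊥v) (coprime-sym (coprime-*ˡ {2} {u} 2⊥v u⊥v))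
        n⊥2u : Coprime n (2 * u)
        n⊥2u = coprime-2* n-odd n⊥u
        last : IsSquare n → (∃ λ z → u ≡ 2 * (z * z)) → IsSquare (p * v) → p ≡ 3 × 2 * n ≡ 2 × t ≡ 1
        -- From s = t and coprimality, s = t = 1; then v = n² + 2t⁴ = 3, so p ∣ 3.
        last (s , refl) (z , u≡) pv□ with x⁴+y⁴≡2z² s t z (Odd-*⁻ˡ s s n-odd) t-odd (sym u≡)
        ... | refl with coprime-self (coprime-∣ˡ (m∣m*n s) n⊥t)
        ...   | refl with prime⇒irreducible prime[3] (prime-square-∣ pp pv□)
        ...     | inj₁ refl = contradiction ∣-refl (prime∤1 pp)
        ...     | inj₂ p≡3  = p≡3 , refl , refl
        classes : (IsSquare v × IsSquare (p * (n * (2 * u)))) ⊎ (IsSquare (p * v) × IsSquare (n * (2 * u))) →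
                  2 * n ≡ 0 ⊎ t ≡ 0 ⊎ (p ≡ 3 × 2 * n ≡ 2 × t ≡ 1)
        classes (inj₁ (v□ , _)) = ⊥-elim (odd-squares-sum₂ n-odd τ-odd v□)
        classes (inj₂ (pv□ , n2u□)) = inj₂ (inj₂ (last (square-factorˡ n⊥2u n2u□) (half-square prime[2] (square-factorʳ n⊥2u n2u□)) pv□))
      halved (inj₁ (k , refl)) = classes (square-class pp 2k⊥v′ (square-factorʳ u⊥rest split))
        where
        v′ : ℕ
        v′ = 2 * (k * k) + τ * τ
        extract : ∀ p k τ → p * (2 * (2 * k) * ((2 * (2 * k) * (2 * (2 * k)) + 4 * (τ * τ)) * (2 * (2 * k) * (2 * (2 * k)) + 8 * (τ * τ)))) ≡
                  8 * 8 * ((2 * k * (2 * k) + τ * τ) * (p * (2 * k * (2 * (k * k) + τ * τ))))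
        extract = solve-∀
        step : ∀ k s → 2 * k * (2 * k) + s * s ≡ 2 * (k * k) + s * s + 2 * (k * k)
        step = solve-∀
        v≡2v′ : ∀ k τ → 2 * k * (2 * k) + 2 * (τ * τ) ≡ 2 * (2 * (k * k) + τ * τ)
        v≡2v′ = solve-∀
        split : IsSquare (u * (p * (n * v′)))
        split = square-unscale 8 (subst IsSquare (extract p k τ) sq)
        u⊥rest : Coprime u (p * (n * v′))
        u⊥rest = coprime-*ʳ (coprime-sym p⊥u) (coprime-*ʳ (coprime-sym n⊥u)
          (coprime-∣ʳ (subst (v′ ∣_) (sym (v≡2v′ k τ)) (n∣m*n 2)) u⊥v))
        2k⊥v′ : Coprime n v′
        2k⊥v′ = coprime-+ˡ (*-pres-∣ {o = 2} {m = 2} {p = k} ∣-refl (m∣m*n k)) (coprime-²ʳ n⊥τ)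
        fourths : IsSquare n → IsSquare u → 2 * n ≡ 0 ⊎ t ≡ 0
        fourths (s , n≡) (z , u≡) = map₁ (λ s²≡0 → cong (2 *_) (trans n≡ s²≡0))
          (fourth-zero {s} (x⁴+y⁴≢□ s t z (trans (sym u≡) (cong (λ n → n * n + τ * τ) n≡))))
        classes : (IsSquare n × IsSquare (p * v′)) ⊎ (IsSquare (p * n) × IsSquare v′) →
                  2 * n ≡ 0 ⊎ t ≡ 0 ⊎ (p ≡ 3 × 2 * n ≡ 2 × t ≡ 1)
        classes (inj₁ (n□ , _)) = map₂ inj₁ (fourths n□ (square-factorˡ u⊥rest split))
        classes (inj₂ (_ , v′□)) = inj₁ (cong (λ k → 2 * (2 * k)) (ap-of {2} no-ap-2 k τ v′ u v′□ (square-factorˡ u⊥rest split)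
          (+-comm (2 * (k * k)) (τ * τ)) (step k τ)))

opaque
  -- For odd m, both m and U are squares, which is s⁴ + 4 q t⁴ = z². For m = 2n the product is 32 n
  -- u v with t odd: u = 2z² would make 2 a residue modulo p, and the remaining cases, u a square
  -- for odd n and v / 2 a square for even n, fail modulo 16.
  quartic-4q : ∀ {p q₀} → Prime p → p % 8 ≡ 5 → .{{_ : NonZero (p * q₀)}} → Primary (p * q₀) → p * q₀ % 16 ≡ 13 →
    ∀ m t → Coprime m t → Coprime (p * q₀) m →
    IsSquare (m * ((m * m + 4 * (p * q₀ * (t * t * (t * t)))) * (m * m + 8 * (p * q₀ * (t * t * (t * t)))))) → m ≡ 0 ⊎ t ≡ 0
  quartic-4q {p} {q₀} pp p%8≡5 primary-q q%16≡13 m t m⊥t q⊥m sq = cases (even-or-odd m)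
    where
    q τ D : ℕ
    q = p * q₀
    τ = t * t
    D = q * (τ * τ)
    nr : TwoNonresidue p
    nr = two-nonresidue pp p%8≡5
    m⊥D : Coprime m D
    m⊥D = coprime-*ʳ {m} {q} (coprime-sym q⊥m) (coprime-²ʳ (coprime-²ʳ m⊥t))
    cases : Even m ⊎ Odd m → m ≡ 0 ⊎ t ≡ 0
    cases (inj₂ m-odd) = inj₂ (descend (square-factorˡ m⊥V (square-factorʳ U⊥mV split)) (square-factorˡ U⊥mV split))
      where
      U V : ℕ
      U = m * m + 4 * D
      V = m * m + 8 * D
      swap : ∀ m u v → m * (u * v) ≡ u * (m * v)
      swap = solve-∀
      split : IsSquare (U * (m * V))
      split = subst IsSquare (swap m U V) sq
      sums : ∀ m d → m * m + 2 * (4 * d) ≡ m * m + 8 * d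
      sums = solve-∀
      m⊥4D : Coprime m (4 * D)
      m⊥4D = coprime-4* m-odd m⊥D
      m⊥V : Coprime m V
      m⊥V = subst (Coprime m) (sums m D) (coprime-+ˡ (m∣m*n m) (coprime-2* m-odd m⊥4D))
      U⊥mV : Coprime U (m * V)
      U⊥mV = coprime-*ʳ (coprime-sym (coprime-+ˡ (m∣m*n m) m⊥4D))
        (subst (Coprime U) (sums m D) (coprime-sums (m * m) (4 * D) (coprime-²ˡ m⊥4D)))
      descend : IsSquare m → IsSquare U → t ≡ 0
      descend (s , m≡) (z , U≡) = x⁴+4qy⁴≢□ {p} {q₀} nr primary-q q%16≡13 t s z (Odd-*⁻ˡ s s (subst Odd m≡ m-odd))
        (coprime-*ʳ {s} {q} (coprime-∣ˡ s∣m (coprime-sym q⊥m)) (coprime-∣ˡ s∣m m⊥t))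
        (trans (sym U≡) (cong (λ m → m * m + 4 * D) m≡))
        where s∣m : s ∣ m
              s∣m = subst (s ∣_) (sym m≡) (m∣m*n s)
    cases (inj₁ (n , refl)) = ⊥-elim (classes (even-or-odd n) (square-class prime[2] u⊥nv
      (square-unscale 4 (subst IsSquare (extract n D) sq))))
      where
      u v : ℕ
      u = n * n + D
      v = n * n + 2 * D
      t-odd : Odd t
      t-odd = coprime-even⇒odd (n , refl) m⊥t
      n⊥D : Coprime n D
      n⊥D = coprime-∣ˡ (n∣m*n 2) m⊥D
      u⊥nv : Coprime u (n * v)
      u⊥nv = coprime-*ʳ (coprime-sym (coprime-+ˡ (m∣m*n n) n⊥D)) (coprime-sums (n * n) D (coprime-²ˡ n⊥D))
      p⊥n : Coprime p n
      p⊥n = coprime-∣ (m∣m*n q₀) (n∣m*n 2) q⊥m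
      extract : ∀ n d → 2 * n * ((2 * n * (2 * n) + 4 * d) * (2 * n * (2 * n) + 8 * d)) ≡
                        4 * 4 * (2 * ((n * n + d) * (n * (n * n + 2 * d))))
      extract = solve-∀
      odd-case : Odd n → Odd t → ¬ IsSquare u
      odd-case (i , refl) (j , refl) (r , eq) = insoluble 16
        ((odd zero ⊗ odd zero ⊕ con 13 ⊗ fourth (odd (suc zero)) , v₂ ⊗ v₂) ∷ []) _ (i ∷ j ∷ r ∷ [])
        (trans (sym (%-coefficient 16 q q%16≡13 (n * n) (τ * τ))) (cong (_% 16) eq) ∷ [])
      even-case : ∀ k → Odd t → ¬ IsSquare (2 * (k * k) + D)
      even-case k (j , refl) (r , eq) = insoluble 16
        ((con 2 ⊗ (v₀ ⊗ v₀) ⊕ con 13 ⊗ fourth (odd (suc zero)) , v₂ ⊗ v₂) ∷ []) _ (k ∷ j ∷ r ∷ [])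
        (trans (sym (%-coefficient 16 q q%16≡13 (2 * (k * k)) (τ * τ))) (cong (_% 16) eq) ∷ [])
      classes : Even n ⊎ Odd n → ¬ ((IsSquare u × IsSquare (2 * (n * v))) ⊎ (IsSquare (2 * u) × IsSquare (n * v)))
      classes _ (inj₂ (2u□ , _)) with half-square prime[2] 2u□
      ... | z , u≡ = TwoNonresidue.2y²≢x² nr n z (q₀ * (τ * τ)) p⊥n (trans (sym u≡) (cong (n * n +_) (*-assoc p q₀ (τ * τ))))
      classes (inj₂ n-odd) (inj₁ (u□ , _)) = odd-case n-odd t-odd u□
      classes (inj₁ (k , refl)) (inj₁ (_ , 2nv□)) = even-case k t-odd
        (square-factorʳ 2k⊥v′ (square-unscale 2 (subst IsSquare (extract′ k D) 2nv□)))
        where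
        extract′ : ∀ k d → 2 * (2 * k * (2 * k * (2 * k) + 2 * d)) ≡ 2 * 2 * (2 * k * (2 * (k * k) + d))
        extract′ = solve-∀
        2k⊥v′ : Coprime n (2 * (k * k) + D)
        2k⊥v′ = coprime-+ˡ (*-pres-∣ {o = 2} {m = 2} {p = k} ∣-refl (m∣m*n k)) n⊥D

opaque
  -- Neither quadratic factor is divisible by p, so e, which is 1 or p, stays with m, and the
  -- factors are squares up to powers of 2. If 4 ∤ m this makes 2 a square modulo p; if m = 4k there
  -- is a progression with difference 2p k².
  quartic-pm² : ∀ {p e} → Prime p → p % 8 ≡ 5 → e ∣ p → ∀ m t → Coprime m t → Coprime p t →
    IsSquare (e * (m * ((p * (m * m) + 4 * (t * t * (t * t))) * (p * (m * m) + 8 * (t * t * (t * t)))))) → m ≡ 0 ⊎ t ≡ 0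
  quartic-pm² {p} {e} pp p%8≡5 e∣p m t m⊥t p⊥t sq = cases (even-or-odd m)
    where
    open TwoNonresidue (two-nonresidue pp p%8≡5)
    τ : ℕ
    τ = t * t
    p-odd : Odd p
    p-odd = odd-if (reduce-% p 2 (divides 4 refl) p%8≡5)
    p⊥τ : Coprime p τ
    p⊥τ = coprime-²ʳ p⊥t
    cases : Even m ⊎ Odd m → m ≡ 0 ⊎ t ≡ 0
    cases (inj₂ m-odd) = ⊥-elim (contra (proj₁ (square-from (swap e m U V) V⊥rest sq)))
      where
      U V : ℕ
      U = p * (m * m) + 4 * (τ * τ)
      V = p * (m * m) + 8 * (τ * τ)
      swap : ∀ e m u v → e * (m * (u * v)) ≡ v * (e * (m * u))
      swap = solve-∀
      double : ∀ τ → 2 * (4 * (τ * τ)) ≡ 8 * (τ * τ)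
      double = solve-∀
      m⊥4τ² : Coprime m (4 * (τ * τ))
      m⊥4τ² = coprime-4* m-odd (coprime-²ʳ (coprime-²ʳ m⊥t))
      p⊥4τ² : Coprime p (4 * (τ * τ))
      p⊥4τ² = coprime-4* p-odd (coprime-²ʳ p⊥τ)
      p⊥V : Coprime p V
      p⊥V = coprime-+ˡ (m∣m*n (m * m)) (subst (Coprime p) (double τ) (coprime-2* p-odd p⊥4τ²))
      m⊥V : Coprime m V
      m⊥V = coprime-+ˡ (∣n⇒∣m*n p (m∣m*n m)) (subst (Coprime m) (double τ) (coprime-2* m-odd m⊥4τ²))
      U⊥V : Coprime U V
      U⊥V = subst (λ w → Coprime U (p * (m * m) + w)) (double τ)
        (coprime-sums (p * (m * m)) (4 * (τ * τ)) (coprime-*ˡ {p} {m * m} p⊥4τ² (coprime-²ˡ m⊥4τ²)))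
      V⊥rest : Coprime V (e * (m * U))
      V⊥rest = coprime-*ʳ (coprime-sym (coprime-∣ˡ e∣p p⊥V)) (coprime-*ʳ (coprime-sym m⊥V) (coprime-sym U⊥V))
      norm : ∀ p m τ → p * (m * m) + 8 * (τ * τ) ≡ 2 * (2 * τ * (2 * τ)) + p * (m * m)
      norm = solve-∀
      contra : ¬ IsSquare V
      contra (w , V≡) = x²≢2y² w (2 * τ) (m * m) (coprime-∣ʳ (subst (w ∣_) (sym V≡) (m∣m*n w)) p⊥V) (trans (sym V≡) (norm p m τ))
    cases (inj₁ (n , refl)) = halved (even-or-odd n)
      where
      u v : ℕ
      u = p * (n * n) + τ * τ
      v = p * (n * n) + 2 * (τ * τ)
      t-odd : Odd t
      t-odd = coprime-even⇒odd (n , refl) m⊥t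
      n⊥τ² : Coprime n (τ * τ)
      n⊥τ² = coprime-²ʳ (coprime-²ʳ (coprime-∣ˡ (n∣m*n 2) m⊥t))
      p⊥u : Coprime p u
      p⊥u = coprime-+ˡ (m∣m*n (n * n)) (coprime-²ʳ p⊥τ)
      n⊥u : Coprime n u
      n⊥u = coprime-+ˡ (∣n⇒∣m*n p (m∣m*n n)) n⊥τ²
      u⊥v : Coprime u v
      u⊥v = coprime-sums (p * (n * n)) (τ * τ) (coprime-*ˡ {p} {n * n} (coprime-²ʳ p⊥τ) (coprime-²ˡ n⊥τ²))
      halved : Even n ⊎ Odd n → 2 * n ≡ 0 ⊎ t ≡ 0
      halved (inj₂ n-odd) = ⊥-elim (contra (half-square prime[2]
        (proj₁ (square-from (extract e p n τ) 2u⊥rest (square-unscale 4 (subst IsSquare (scale e p n τ) sq))))))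
        where
        scale : ∀ e p n τ → e * (2 * n * ((p * (2 * n * (2 * n)) + 4 * (τ * τ)) * (p * (2 * n * (2 * n)) + 8 * (τ * τ)))) ≡
                4 * 4 * (2 * (e * (n * ((p * (n * n) + τ * τ) * (p * (n * n) + 2 * (τ * τ))))))
        scale = solve-∀
        extract : ∀ e p n τ → 2 * (e * (n * ((p * (n * n) + τ * τ) * (p * (n * n) + 2 * (τ * τ))))) ≡
                  2 * (p * (n * n) + τ * τ) * (e * (n * (p * (n * n) + 2 * (τ * τ))))
        extract = solve-∀
        v-odd : Odd v
        v-odd = odd-coprime (coprime-+ʳ (m∣m*n (τ * τ)) (coprime-odd (Odd-* p-odd (Odd-* n-odd n-odd))))
        2u⊥rest : Coprime (2 * u) (e * (n * v))
        2u⊥rest = coprime-*ʳ (coprime-sym (coprime-∣ˡ e∣p (coprime-2* p-odd p⊥u)))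
          (coprime-*ʳ (coprime-sym (coprime-2* n-odd n⊥u)) (coprime-sym (coprime-2* v-odd (coprime-sym u⊥v))))
        contra : ¬ (∃ λ z → u ≡ 2 * (z * z))
        contra (z , u≡) = 2y²≢x² τ z (n * n) p⊥τ (trans (sym u≡) (+-comm (p * (n * n)) (τ * τ)))
      halved (inj₁ (k , refl)) = inj₁ (cong (λ k → 2 * (2 * k)) (ap-of {2 * p} (no-ap-2p pp p%8≡5) k τ v′ u
        (proj₁ (square-from (extract-v e p k τ) v′⊥rest reduced)) (proj₁ (square-from (extract-u e p k τ) u⊥rest reduced))
        (first p k τ) (second p k τ)))
        where
        v′ : ℕ
        v′ = 2 * (p * (k * k)) + τ * τ
        scale : ∀ e p k τ → e * (2 * (2 * k) * ((p * (2 * (2 * k) * (2 * (2 * k))) + 4 * (τ * τ)) * (p * (2 * (2 * k) * (2 * (2 * k))) + 8 * (τ * τ)))) ≡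
                8 * 8 * (e * (2 * k * ((p * (2 * k * (2 * k)) + τ * τ) * (2 * (p * (k * k)) + τ * τ))))
        scale = solve-∀
        extract-u : ∀ e p k τ → e * (2 * k * ((p * (2 * k * (2 * k)) + τ * τ) * (2 * (p * (k * k)) + τ * τ))) ≡
                    (p * (2 * k * (2 * k)) + τ * τ) * (e * (2 * k * (2 * (p * (k * k)) + τ * τ)))
        extract-u = solve-∀
        extract-v : ∀ e p k τ → e * (2 * k * ((p * (2 * k * (2 * k)) + τ * τ) * (2 * (p * (k * k)) + τ * τ))) ≡
                    (2 * (p * (k * k)) + τ * τ) * (e * (2 * k * (p * (2 * k * (2 * k)) + τ * τ)))
        extract-v = solve-∀
        first : ∀ p k τ → 2 * (p * (k * k)) + τ * τ ≡ τ * τ + 2 * p * (k * k)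
        first = solve-∀
        second : ∀ p k τ → p * (2 * k * (2 * k)) + τ * τ ≡ 2 * (p * (k * k)) + τ * τ + 2 * p * (k * k)
        second = solve-∀
        v≡2v′ : ∀ p k τ → p * (2 * k * (2 * k)) + 2 * (τ * τ) ≡ 2 * (2 * (p * (k * k)) + τ * τ)
        v≡2v′ = solve-∀
        reduced : IsSquare (e * (n * (u * v′)))
        reduced = square-unscale 8 (subst IsSquare (scale e p k τ) sq)
        u⊥v′ : Coprime u v′
        u⊥v′ = coprime-∣ʳ (subst (v′ ∣_) (sym (v≡2v′ p k τ)) (n∣m*n 2)) u⊥v
        p⊥v′ : Coprime p v′
        p⊥v′ = coprime-+ˡ (∣n⇒∣m*n 2 (m∣m*n (k * k))) (coprime-²ʳ p⊥τ)
        n⊥v′ : Coprime n v′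
        n⊥v′ = coprime-+ˡ (*-pres-∣ {o = 2} {m = 2} {p = k} ∣-refl (∣n⇒∣m*n p (m∣m*n k))) n⊥τ²
        u⊥rest : Coprime u (e * (n * v′))
        u⊥rest = coprime-*ʳ (coprime-sym (coprime-∣ˡ e∣p p⊥u)) (coprime-*ʳ (coprime-sym n⊥u) u⊥v′)
        v′⊥rest : Coprime v′ (e * (n * u))
        v′⊥rest = coprime-*ʳ (coprime-sym (coprime-∣ˡ e∣p p⊥v′)) (coprime-*ʳ (coprime-sym n⊥v′) (coprime-sym u⊥v′))

-- The curves, according to whether p divides the numerator of x

opaque
  -- The coefficients are spelled the way `2 ^ i * p ^ j` unfolds, so that the result fits
  -- `only-origin` as it stands.
  curve₁ : ∀ {p} → Prime p → ∀ m t → Coprime m t →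
    IsSquare (m * ((m * m + 1 * (p * (p * 1)) * (t * t * (t * t))) * (m * m + 2 * (p * (p * 1)) * (t * t * (t * t))))) → m ≡ 0 ⊎ t ≡ 0
  curve₁ {p} pp m t m⊥t sq with prime-coprime-or-∣ pp m
  ... | inj₁ p⊥m = map₂ (λ ptt≡0 → sq≡0 (*-cancelˡ-≡ (t * t) 0 p {{prime⇒nonZero pp}} (trans ptt≡0 (sym (*-zeroʳ p)))))
      (quartic-d² m (p * (t * t)) (coprime-*ʳ {m} {p} (coprime-sym p⊥m) (coprime-²ʳ m⊥t)) (subst IsSquare (shape m p (t * t)) sq))
    where
    shape : ∀ m p τ → m * ((m * m + 1 * (p * (p * 1)) * (τ * τ)) * (m * m + 2 * (p * (p * 1)) * (τ * τ))) ≡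
            m * ((m * m + p * τ * (p * τ)) * (m * m + 2 * (p * τ * (p * τ))))
    shape = solve-∀
  ... | inj₂ (divides k refl) = map₁ (cong (_* p)) (quartic-p pp k t (coprime-∣ˡ (m∣m*n p) m⊥t)
      (square-unscale (p * p) {{m*n≢0 p p}} (subst IsSquare (scale k p (t * t)) sq)))
    where
    instance
      nonZero-p : NonZero p
      nonZero-p = prime⇒nonZero pp
    scale : ∀ k p τ → k * p * ((k * p * (k * p) + 1 * (p * (p * 1)) * (τ * τ)) * (k * p * (k * p) + 2 * (p * (p * 1)) * (τ * τ))) ≡
            p * p * (p * p) * (p * (k * ((k * k + τ * τ) * (k * k + 2 * (τ * τ)))))
    scale = solve-∀

  curve₂ : ∀ {p} → Prime p → p % 4 ≡ 3 → ∀ m t → Coprime m t →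
    IsSquare (m * ((m * m + 4 * (p * (p * 1)) * (t * t * (t * t))) * (m * m + 8 * (p * (p * 1)) * (t * t * (t * t))))) →
    m ≡ 0 ⊎ t ≡ 0 ⊎ (p ≡ 3 × m ≡ 2 * p × t ≡ 1)
  curve₂ {p} pp p%4≡3 m t m⊥t sq with prime-coprime-or-∣ pp m
  ... | inj₁ p⊥m = map₂ (λ ptt≡0 → inj₁ (sq≡0 (*-cancelˡ-≡ (t * t) 0 p {{prime⇒nonZero pp}} (trans ptt≡0 (sym (*-zeroʳ p))))))
      (quartic-4d² m (p * (t * t)) (coprime-*ʳ {m} {p} (coprime-sym p⊥m) (coprime-²ʳ m⊥t)) (subst IsSquare (shape m p (t * t)) sq))
    where
    shape : ∀ m p τ → m * ((m * m + 4 * (p * (p * 1)) * (τ * τ)) * (m * m + 8 * (p * (p * 1)) * (τ * τ))) ≡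
            m * ((m * m + 4 * (p * τ * (p * τ))) * (m * m + 8 * (p * τ * (p * τ))))
    shape = solve-∀
  ... | inj₂ (divides k refl) = [ (λ k≡0 → inj₁ (cong (_* p) k≡0))
      , [ (λ t≡0 → inj₂ (inj₁ t≡0)) , (λ (p≡3 , k≡2 , t≡1) → inj₂ (inj₂ (p≡3 , cong (_* p) k≡2 , t≡1))) ]′ ]′
      (quartic-4p pp p%4≡3 k t (coprime-∣ˡ (m∣m*n p) m⊥t) (coprime-∣ˡ (n∣m*n k) m⊥t)
        (square-unscale (p * p) {{m*n≢0 p p}} (subst IsSquare (scale k p (t * t)) sq)))
    where
    instance
      nonZero-p : NonZero p
      nonZero-p = prime⇒nonZero pp
    scale : ∀ k p τ → k * p * ((k * p * (k * p) + 4 * (p * (p * 1)) * (τ * τ)) * (k * p * (k * p) + 8 * (p * (p * 1)) * (τ * τ))) ≡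
            p * p * (p * p) * (p * (k * ((k * k + 4 * (τ * τ)) * (k * k + 8 * (τ * τ)))))
    scale = solve-∀

  curve₃ : ∀ {p} → Prime p → p % 16 ≡ 13 → ∀ m t → Coprime m t →
    IsSquare (m * ((m * m + 4 * (p * 1) * (t * t * (t * t))) * (m * m + 8 * (p * 1) * (t * t * (t * t))))) → m ≡ 0 ⊎ t ≡ 0
  curve₃ {p} pp p%16≡13 m t m⊥t sq with prime-coprime-or-∣ pp m
  ... | inj₁ p⊥m = quartic-4q {p} {1} pp (reduce-% p 8 (divides 2 refl) p%16≡13)
      {{subst NonZero (sym (*-identityʳ p)) (prime⇒nonZero pp)}} (subst Primary (sym (*-identityʳ p)) (primary-prime pp))
      (trans (cong (_% 16) (*-identityʳ p)) p%16≡13) m t m⊥t (subst (λ q → Coprime q m) (sym (*-identityʳ p)) p⊥m)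
      (subst IsSquare (cong₂ (λ u v → m * ((m * m + u) * (m * m + v))) (*-assoc 4 (p * 1) _) (*-assoc 8 (p * 1) _)) sq)
  -- Three factors p leave the product; p² is cancelled and one remains as e = p.
  ... | inj₂ (divides k refl) = map₁ (cong (_* p)) (quartic-pm² pp (reduce-% p 8 (divides 2 refl) p%16≡13) ∣-refl k t
      (coprime-∣ˡ (m∣m*n p) m⊥t) (coprime-∣ˡ (n∣m*n k) m⊥t) (square-unscale p (subst IsSquare (scale k p (t * t)) sq)))
    where
    instance
      nonZero-p : NonZero p
      nonZero-p = prime⇒nonZero pp
    scale : ∀ k p τ → k * p * ((k * p * (k * p) + 4 * (p * 1) * (τ * τ)) * (k * p * (k * p) + 8 * (p * 1) * (τ * τ))) ≡
            p * p * (p * (k * ((p * (k * k) + 4 * (τ * τ)) * (p * (k * k) + 8 * (τ * τ)))))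
    scale = solve-∀

  curve₄ : ∀ {p} → Prime p → p % 16 ≡ 5 → ∀ m t → Coprime m t →
    IsSquare (m * ((m * m + 4 * (p * (p * (p * 1))) * (t * t * (t * t))) * (m * m + 8 * (p * (p * (p * 1))) * (t * t * (t * t))))) → m ≡ 0 ⊎ t ≡ 0
  curve₄ {p} pp p%16≡5 m t m⊥t sq with prime-coprime-or-∣ pp m
  ... | inj₁ p⊥m = quartic-4q {p} {p * p} pp (reduce-% p 8 (divides 2 refl) p%16≡5) {{m*n≢0 p (p * p) {{prime⇒nonZero pp}} {{m*n≢0 p p {{prime⇒nonZero pp}} {{prime⇒nonZero pp}}}}}}
      (primary-cube (primary-prime pp)) cube%16 m t m⊥t (coprime-*ˡ {p} {p * p} p⊥m (coprime-²ˡ p⊥m)) (subst IsSquare (shape m p (t * t)) sq)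
    where
    -- Since 5³ = 125 = 7 * 16 + 13, the cube of p lies in the class required of q.
    cube%16 : p * (p * p) % 16 ≡ 13
    cube%16 = trans (%-distribˡ-* p (p * p) 16) (trans (cong (λ r → p % 16 * r % 16) (%-distribˡ-* p p 16))
      (cong (λ r → r * (r * r % 16) % 16) p%16≡5))
    shape : ∀ m p τ → m * ((m * m + 4 * (p * (p * (p * 1))) * (τ * τ)) * (m * m + 8 * (p * (p * (p * 1))) * (τ * τ))) ≡
            m * ((m * m + 4 * (p * (p * p) * (τ * τ))) * (m * m + 8 * (p * (p * p) * (τ * τ))))
    shape = solve-∀
  ... | inj₂ (divides k refl) = map₁ (cong (_* p)) (again p∣k reduced)
    where
    instance
      nonZero-p : NonZero p
      nonZero-p = prime⇒nonZero pp
    τ : ℕ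
    τ = t * t
    U V : ℕ → ℕ
    U k = k * k + 4 * p * (τ * τ)
    V k = k * k + 8 * p * (τ * τ)
    scale : ∀ k p τ → k * p * ((k * p * (k * p) + 4 * (p * (p * (p * 1))) * (τ * τ)) * (k * p * (k * p) + 8 * (p * (p * (p * 1))) * (τ * τ))) ≡
            p * p * (p * p) * (p * (k * ((k * k + 4 * p * (τ * τ)) * (k * k + 8 * p * (τ * τ)))))
    scale = solve-∀
    reduced : IsSquare (p * (k * (U k * V k)))
    reduced = square-unscale (p * p) {{m*n≢0 p p}} (subst IsSquare (scale k p τ) sq)
    from-square : ∀ c → p ∣ k * k + c * p * (τ * τ) → p ∣ k
    from-square c p∣ = prime-∣² {n = k} pp (∣m+n∣m⇒∣n (subst (p ∣_) (+-comm (k * k) (c * p * (τ * τ))) p∣) (∣m⇒∣m*n (τ * τ) (n∣m*n c)))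
    -- Both quadratic factors are k² modulo p, so p divides k whichever of the three factors it
    -- divides.
    p∣k : p ∣ k
    p∣k = [ id , (λ p∣UV → [ from-square 4 , from-square 8 ]′ (euclidsLemma (U k) (V k) pp p∣UV)) ]′
          (euclidsLemma k (U k * V k) pp (prime-square-∣ pp reduced))
    scale′ : ∀ l p τ → p * (l * p * ((l * p * (l * p) + 4 * p * (τ * τ)) * (l * p * (l * p) + 8 * p * (τ * τ)))) ≡
             p * p * (p * p) * (1 * (l * ((p * (l * l) + 4 * (τ * τ)) * (p * (l * l) + 8 * (τ * τ)))))
    scale′ = solve-∀
    -- A second factor p leaves m. Now exactly p⁴ is cancelled, so e = 1.
    again : p ∣ k → IsSquare (p * (k * (U k * V k))) → k ≡ 0 ⊎ t ≡ 0
    again (divides l k≡) sq = map₁ (λ l≡0 → trans k≡ (cong (_* p) l≡0)) (quartic-pm² {p} {1} pp (reduce-% p 8 (divides 2 refl) p%16≡5) (1∣ p) l t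
      (coprime-∣ˡ (∣-trans (subst (l ∣_) (sym k≡) (m∣m*n p)) (m∣m*n p)) m⊥t) (coprime-∣ˡ (n∣m*n k) m⊥t)
      (square-unscale (p * p) {{m*n≢0 p p}} (subst IsSquare (trans (cong (λ k → p * (k * (U k * V k))) k≡) (scale′ l p τ)) sq)))

-- From rational to integral points

open import Defs
open import Data.Integer using (+_; -_; -[1+_]; +0)
import Data.Integer as ℤ
import Data.Integer.Properties as ℤ
import Data.Nat.Coprimality as Coprimality
open import Data.Rational using (ℚ; mkℚ; _/_; 0ℚ; ↥_; ↧ₙ_; toℚᵘ)
import Data.Rational as ℚ
import Data.Rational.Properties as ℚ
open import Data.Rational.Unnormalised using (mkℚᵘ; _≃_; *≡*)
import Data.Rational.Unnormalised as ℚᵘ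
import Data.Rational.Unnormalised.Properties as ℚᵘ

-- `square` serves to determine x, and `equation` to recover y afterwards. Its unsimplified
-- denominators are those of cross-multiplied unnormalised rationals.
record IntegralPoint (a b : ℕ) (x y : ℚ) : Set where
  field
    m t : ℕ
    m⊥t : Coprime m t
    numerator : ↥ x ≡ + m
    denominator : ↧ₙ x ≡ t * t
    square : IsSquare (m * ((m * m + a * (t * t * (t * t))) * (m * m + b * (t * t * (t * t)))))
    equation : ℤ.∣ ↥ y ∣ * ℤ.∣ ↥ y ∣ * (↧ₙ x * (↧ₙ x * ↧ₙ x * 1) * (↧ₙ x * ↧ₙ x * 1)) ≡
               m * ((m * m + a * (↧ₙ x * ↧ₙ x)) * (m * m + b * (↧ₙ x * ↧ₙ x)) * (↧ₙ y * ↧ₙ y))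

square-abs : ∀ i → i ℤ.* i ≡ + (ℤ.∣ i ∣ * ℤ.∣ i ∣)
square-abs (+ n)    = sym (ℤ.pos-* n n)
square-abs -[1+ n ] = refl

quadratic-abs : ∀ i a d → i ℤ.* i ℤ.* + 1 ℤ.+ + a ℤ.* + d ≡ + (ℤ.∣ i ∣ * ℤ.∣ i ∣ + a * d)
quadratic-abs i a d = trans
  (cong₂ ℤ._+_ (trans (ℤ.*-identityʳ (i ℤ.* i)) (square-abs i)) (sym (ℤ.pos-* a d)))
  (sym (ℤ.pos-+ (ℤ.∣ i ∣ * ℤ.∣ i ∣) (a * d)))

-- The factors 1 are denominators of the integral coefficients. Isolating i against a natural number
-- lets its sign be read off.
cleared : ∀ a b i j n s →
  j ℤ.* j ℤ.* + (n * (n * n * 1) * (n * n * 1)) ≡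
    i ℤ.* (i ℤ.* i ℤ.* + 1 ℤ.+ + a ℤ.* + (n * n)) ℤ.* (i ℤ.* i ℤ.* + 1 ℤ.+ + b ℤ.* + (n * n)) ℤ.* + (s * s) →
  + (ℤ.∣ j ∣ * ℤ.∣ j ∣ * (n * (n * n * 1) * (n * n * 1))) ≡
    i ℤ.* + ((ℤ.∣ i ∣ * ℤ.∣ i ∣ + a * (n * n)) * (ℤ.∣ i ∣ * ℤ.∣ i ∣ + b * (n * n)) * (s * s))
cleared a b i j n s eq = begin
  + (R * D)                                     ≡⟨ ℤ.pos-* R D ⟩
  + R ℤ.* + D                                   ≡⟨ cong (ℤ._* + D) (square-abs j) ⟨
  j ℤ.* j ℤ.* + D                               ≡⟨ eq ⟩
  _                                             ≡⟨ cong₂ (λ u v → i ℤ.* u ℤ.* v ℤ.* + (s * s)) (quadratic-abs i a (n * n)) (quadratic-abs i b (n * n)) ⟩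
  i ℤ.* + U ℤ.* + V ℤ.* + (s * s)               ≡⟨ cong (ℤ._* + (s * s)) (ℤ.*-assoc i (+ U) (+ V)) ⟩
  i ℤ.* (+ U ℤ.* + V) ℤ.* + (s * s)             ≡⟨ ℤ.*-assoc i (+ U ℤ.* + V) (+ (s * s)) ⟩
  i ℤ.* (+ U ℤ.* + V ℤ.* + (s * s))             ≡⟨ cong (λ w → i ℤ.* (w ℤ.* + (s * s))) (ℤ.pos-* U V) ⟨
  i ℤ.* (+ (U * V) ℤ.* + (s * s))               ≡⟨ cong (i ℤ.*_) (ℤ.pos-* (U * V) (s * s)) ⟨
  i ℤ.* + (U * V * (s * s))                     ∎
  where
  open ≡-Reasoning
  R D U V : ℕ
  R = ℤ.∣ j ∣ * ℤ.∣ j ∣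
  D = n * (n * n * 1) * (n * n * 1)
  U = ℤ.∣ i ∣ * ℤ.∣ i ∣ + a * (n * n)
  V = ℤ.∣ i ∣ * ℤ.∣ i ∣ + b * (n * n)

opaque
  -- Multiplication by n turns the left side into (r n³)², so n m U V is a square once s² is
  -- cancelled. As n is prime to m, U and V, it is itself a square.
  integral-square : ∀ a b r m n s .{{_ : NonZero s}} → Coprime m n →
    r * r * (n * (n * n * 1) * (n * n * 1)) ≡ m * ((m * m + a * (n * n)) * (m * m + b * (n * n)) * (s * s)) →
    ∃ λ t → n ≡ t * t × IsSquare (m * ((m * m + a * (t * t * (t * t))) * (m * m + b * (t * t * (t * t)))))
  integral-square a b r m n s m⊥n eq = finish (square-factorˡ n⊥mUV nmUV□) (square-factorʳ n⊥mUV nmUV□)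
    where
    U V : ℕ
    U = m * m + a * (n * n)
    V = m * m + b * (n * n)
    gather : ∀ r n → n * (r * r * (n * (n * n * 1) * (n * n * 1))) ≡ r * (n * n * n) * (r * (n * n * n))
    gather = solve-∀
    regroup : ∀ n m u v s → n * (m * (u * v * (s * s))) ≡ s * s * (n * (m * (u * v)))
    regroup = solve-∀
    nmUV□ : IsSquare (n * (m * (U * V)))
    nmUV□ = square-unscale s (r * (n * n * n) , trans (sym (regroup n m U V s)) (trans (cong (n *_) (sym eq)) (gather r n)))
    n⊥sum : ∀ c → Coprime n (m * m + c * (n * n))
    n⊥sum c = coprime-+ʳ (∣n⇒∣m*n c (m∣m*n n)) (coprime-²ʳ (coprime-sym m⊥n))
    n⊥mUV : Coprime n (m * (U * V))
    n⊥mUV = coprime-*ʳ (coprime-sym m⊥n) (coprime-*ʳ (n⊥sum a) (n⊥sum b))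
    finish : IsSquare n → IsSquare (m * (U * V)) →
      ∃ λ t → n ≡ t * t × IsSquare (m * ((m * m + a * (t * t * (t * t))) * (m * m + b * (t * t * (t * t)))))
    finish (t , refl) sq = t , refl , sq

-- Operations on unnormalised rationals compute without gcds, so the curve equation becomes one
-- between explicit integers.
to-unnormalised : ∀ {A B} x y {a b} → toℚᵘ A ≃ mkℚᵘ (+ a) 0 → toℚᵘ B ≃ mkℚᵘ (+ b) 0 →
  y ℚ.* y ≡ x ℚ.* (x ℚ.* x ℚ.+ A) ℚ.* (x ℚ.* x ℚ.+ B) →
  toℚᵘ y ℚᵘ.* toℚᵘ y ≃ toℚᵘ x ℚᵘ.* (toℚᵘ x ℚᵘ.* toℚᵘ x ℚᵘ.+ mkℚᵘ (+ a) 0) ℚᵘ.* (toℚᵘ x ℚᵘ.* toℚᵘ x ℚᵘ.+ mkℚᵘ (+ b) 0)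
to-unnormalised {A} {B} x y A≃ B≃ eq =
  ℚᵘ.≃-trans (ℚᵘ.≃-sym (ℚ.toℚᵘ-homo-* y y)) (ℚᵘ.≃-trans (ℚ.toℚᵘ-cong eq)
  (ℚᵘ.≃-trans (ℚ.toℚᵘ-homo-* (x ℚ.* (x ℚ.* x ℚ.+ A)) (x ℚ.* x ℚ.+ B))
  (ℚᵘ.*-cong (ℚᵘ.≃-trans (ℚ.toℚᵘ-homo-* x (x ℚ.* x ℚ.+ A)) (ℚᵘ.*-congˡ {toℚᵘ x} (factor A≃))) (factor B≃))))
  where
  factor : ∀ {C c} → toℚᵘ C ≃ mkℚᵘ (+ c) 0 → toℚᵘ (x ℚ.* x ℚ.+ C) ≃ toℚᵘ x ℚᵘ.* toℚᵘ x ℚᵘ.+ mkℚᵘ (+ c) 0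
  factor {C} C≃ = ℚᵘ.≃-trans (ℚ.toℚᵘ-homo-+ (x ℚ.* x) C) (ℚᵘ.+-cong (ℚ.toℚᵘ-homo-* x x) C≃)

opaque
  integral-point : ∀ {A B} a b x y → toℚᵘ A ≃ mkℚᵘ (+ a) 0 → toℚᵘ B ≃ mkℚᵘ (+ b) 0 →
    y ℚ.* y ≡ x ℚ.* (x ℚ.* x ℚ.+ A) ℚ.* (x ℚ.* x ℚ.+ B) → IntegralPoint a b x y
  integral-point a b x@(mkℚ (+ m) n-1 c) y@(mkℚ j s-1 _) A≃ B≃ eq with to-unnormalised x y A≃ B≃ eq
  ... | *≡* e = record
    { m = m ; t = proj₁ root ; m⊥t = coprime-∣ʳ (subst (proj₁ root ∣_) (sym (proj₁ (proj₂ root))) (m∣m*n (proj₁ root))) m⊥n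
    ; numerator = refl ; denominator = proj₁ (proj₂ root) ; square = proj₂ (proj₂ root) ; equation = equation }
    where
    m⊥n : Coprime m (suc n-1)
    m⊥n = Coprimality.recompute c
    W : ℕ
    W = (m * m + a * (suc n-1 * suc n-1)) * (m * m + b * (suc n-1 * suc n-1)) * (suc s-1 * suc s-1)
    equation : ℤ.∣ j ∣ * ℤ.∣ j ∣ * (suc n-1 * (suc n-1 * suc n-1 * 1) * (suc n-1 * suc n-1 * 1)) ≡ m * W
    equation = ℤ.+-injective (trans (cleared a b (+ m) j (suc n-1) (suc s-1) e) (sym (ℤ.pos-* m W)))
    root : ∃ λ t → suc n-1 ≡ t * t × IsSquare (m * ((m * m + a * (t * t * (t * t))) * (m * m + b * (t * t * (t * t)))))
    root = integral-square a b ℤ.∣ j ∣ m (suc n-1) (suc s-1) m⊥n equation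
  -- A negative numerator makes the right side negative, the other factors being positive, while the
  -- left side is a natural number.
  integral-point a b x@(mkℚ -[1+ m ] n-1 c) y@(mkℚ j s-1 _) A≃ B≃ eq with to-unnormalised x y A≃ B≃ eq
  ... | *≡* e = case cleared a b -[1+ m ] j (suc n-1) (suc s-1) e of λ ()

opaque
  origin : ∀ {a b x y} → IntegralPoint a b x y → ↥ x ≡ +0 → aff x y ≡ aff 0ℚ 0ℚ
  origin {a} {b} {x@(mkℚ _ n-1 _)} {y} P refl = cong₂ aff (ℚ.↥p≡0⇒p≡0 x refl) (ℚ.↥p≡0⇒p≡0 y (ℤ.∣i∣≡0⇒i≡0 ∣y∣≡0))
    where
    open IntegralPoint P
    instance
      nonZero-d : NonZero (suc n-1 * (suc n-1 * suc n-1 * 1) * (suc n-1 * suc n-1 * 1))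
      nonZero-d = _
    m≡0 : m ≡ 0
    m≡0 = ℤ.+-injective (sym numerator)
    ∣y∣² : ℤ.∣ ↥ y ∣ * ℤ.∣ ↥ y ∣ ≡ 0
    ∣y∣² = m*n≡0⇒m≡0 (ℤ.∣ ↥ y ∣ * ℤ.∣ ↥ y ∣) _ (trans equation (cong (λ m → m * ((m * m + a * (suc n-1 * suc n-1)) * (m * m + b * (suc n-1 * suc n-1)) * (↧ₙ y * ↧ₙ y))) m≡0))
    ∣y∣≡0 : ℤ.∣ ↥ y ∣ ≡ 0
    ∣y∣≡0 = sq-injective {ℤ.∣ ↥ y ∣} {0} ∣y∣²

t≢0 : ∀ {a b x y} (P : IntegralPoint a b x y) → IntegralPoint.t P ≢ 0
t≢0 {x = mkℚ _ _ _} P t≡0 = case trans (IntegralPoint.denominator P) (cong (λ t → t * t) t≡0) of λ ()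

trivial-point : ∀ {a b x y} (P : IntegralPoint a b x y) → IntegralPoint.m P ≡ 0 ⊎ IntegralPoint.t P ≡ 0 → aff x y ≡ aff 0ℚ 0ℚ
trivial-point P (inj₁ m≡0) = origin P (trans (IntegralPoint.numerator P) (cong +_ m≡0))
trivial-point P (inj₂ t≡0) = contradiction t≡0 (t≢0 P)

coefficient : ∀ m n → toℚᵘ ((+ m / 1) ℚ.* (+ n / 1)) ≃ mkℚᵘ (+ (m * n)) 0
coefficient m n = ℚᵘ.≃-trans (ℚ.toℚᵘ-homo-* (+ m / 1) (+ n / 1))
  (ℚᵘ.≃-trans (ℚᵘ.*-cong (ℚ.toℚᵘ-fromℚᵘ (mkℚᵘ (+ m) 0)) (ℚ.toℚᵘ-fromℚᵘ (mkℚᵘ (+ n) 0)))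
  (ℚᵘ.≃-reflexive (cong (λ k → mkℚᵘ k 0) (sym (ℤ.pos-* m n)))))

origin-on-curve : ∀ p i j → OnCurve p i j (aff 0ℚ 0ℚ)
origin-on-curve p i j = trans (ℚ.*-zeroˡ 0ℚ) (sym (trans (cong (ℚ._* v) (ℚ.*-zeroˡ u)) (ℚ.*-zeroˡ v)))
  where
  u v : ℚ
  u = 0ℚ ℚ.* 0ℚ ℚ.+ coef p i j
  v = 0ℚ ℚ.* 0ℚ ℚ.+ coef p (i ℤ.+ + 1) j

point-of : ∀ p i j x y → OnCurve p (+ i) (+ j) (aff x y) → IntegralPoint (2 ^ i * p ^ j) (2 ^ (i + 1) * p ^ j) x y
point-of p i j x y = integral-point (2 ^ i * p ^ j) (2 ^ (i + 1) * p ^ j) x y (coefficient (2 ^ i) (p ^ j)) (coefficient (2 ^ (i + 1)) (p ^ j))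

only-origin : ∀ p i j →
  (∀ m t → Coprime m t → IsSquare (m * ((m * m + 2 ^ i * p ^ j * (t * t * (t * t))) * (m * m + 2 ^ (i + 1) * p ^ j * (t * t * (t * t))))) → m ≡ 0 ⊎ t ≡ 0) →
  ∀ P → OnCurve p (+ i) (+ j) P ⇔ (P ≡ aff 0ℚ 0ℚ ⊎ P ≡ ∞)
only-origin p i j trivial P = mk⇔ (to P) (from P)
  where
  to : ∀ P → OnCurve p (+ i) (+ j) P → P ≡ aff 0ℚ 0ℚ ⊎ P ≡ ∞
  to ∞ _ = inj₂ refl
  to (aff x y) on = inj₁ (trivial-point Q (trivial m t m⊥t square))
    where
    Q : IntegralPoint (2 ^ i * p ^ j) (2 ^ (i + 1) * p ^ j) x y
    Q = point-of p i j x y on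
    open IntegralPoint Q
  from : ∀ P → P ≡ aff 0ℚ 0ℚ ⊎ P ≡ ∞ → OnCurve p (+ i) (+ j) P
  from _ (inj₁ refl) = origin-on-curve p (+ i) (+ j)
  from _ (inj₂ refl) = _

opaque
  exceptional : ∀ {x y} (P : IntegralPoint 36 72 x y) → IntegralPoint.m P ≡ 6 → IntegralPoint.t P ≡ 1 →
    aff x y ≡ aff (+ 6 / 1) (+ 216 / 1) ⊎ aff x y ≡ aff (+ 6 / 1) ((- (+ 216)) / 1)
  exceptional {mkℚ i n-1 d} {mkℚ j s-1 c} P m≡6 t≡1
    with trans (IntegralPoint.numerator P) (cong +_ m≡6) | trans (IntegralPoint.denominator P) (cong (λ t → t * t) t≡1)
  ... | refl | refl = sign j c root s≡1
    where
    s : ℕ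
    s = suc s-1
    -- At x = 6 the right-hand side of the curve is 6 * 72 * 108 = 216².
    ∣y∣²≡ : ℤ.∣ j ∣ * ℤ.∣ j ∣ ≡ 216 * s * (216 * s)
    ∣y∣²≡ = begin
      ℤ.∣ j ∣ * ℤ.∣ j ∣       ≡⟨ *-identityʳ (ℤ.∣ j ∣ * ℤ.∣ j ∣) ⟨
      ℤ.∣ j ∣ * ℤ.∣ j ∣ * 1   ≡⟨ IntegralPoint.equation P ⟩
      _                       ≡⟨ cong (λ m → m * ((m * m + 36 * 1) * (m * m + 72 * 1) * (s * s))) m≡6 ⟩
      6 * (7776 * (s * s))    ≡⟨ *-assoc 6 7776 (s * s) ⟨
      216 * 216 * (s * s)     ≡⟨ [m*n]*[o*p]≡[m*o]*[n*p] 216 s 216 s ⟨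
      216 * s * (216 * s)     ∎
      where open ≡-Reasoning
    root : ℤ.∣ j ∣ ≡ 216 * s
    root = sq-injective ∣y∣²≡
    -- The denominator s divides the numerator 216 s of a fraction in lowest terms.
    s≡1 : s ≡ 1
    s≡1 = Coprimality.recompute c (subst (s ∣_) (sym root) (n∣m*n 216) , ∣-refl)
    sign : ∀ j .(c : Coprime ℤ.∣ j ∣ s) → ℤ.∣ j ∣ ≡ 216 * s → s ≡ 1 →
      aff (mkℚ (+ 6) 0 d) (mkℚ j s-1 c) ≡ aff (+ 6 / 1) (+ 216 / 1) ⊎
      aff (mkℚ (+ 6) 0 d) (mkℚ j s-1 c) ≡ aff (+ 6 / 1) ((- (+ 216)) / 1)
    sign (+ n)    c refl refl = inj₁ refl
    sign -[1+ n ] c eq   refl with suc-injective eq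
    ... | refl = inj₂ refl

exceptional-curve : ∀ P → OnCurve 3 (+ 2) (+ 2) P
  ⇔ (P ≡ aff 0ℚ 0ℚ ⊎ P ≡ aff (+ 6 / 1) (+ 216 / 1) ⊎ P ≡ aff (+ 6 / 1) ((- (+ 216)) / 1) ⊎ P ≡ ∞)
exceptional-curve P = mk⇔ (to P) (from P)
  where
  Listed : Point → Set
  Listed P = P ≡ aff 0ℚ 0ℚ ⊎ P ≡ aff (+ 6 / 1) (+ 216 / 1) ⊎ P ≡ aff (+ 6 / 1) ((- (+ 216)) / 1) ⊎ P ≡ ∞
  to : ∀ P → OnCurve 3 (+ 2) (+ 2) P → Listed P
  to ∞ _ = inj₂ (inj₂ (inj₂ refl))
  to (aff x y) on = classify (curve₂ prime[3] refl m t m⊥t square)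
    where
    Q : IntegralPoint 36 72 x y
    Q = point-of 3 2 2 x y on
    open IntegralPoint Q
    classify : m ≡ 0 ⊎ t ≡ 0 ⊎ (3 ≡ 3 × m ≡ 6 × t ≡ 1) → Listed (aff x y)
    classify (inj₁ m≡0) = inj₁ (trivial-point Q (inj₁ m≡0))
    classify (inj₂ (inj₁ t≡0)) = inj₁ (trivial-point Q (inj₂ t≡0))
    classify (inj₂ (inj₂ (_ , m≡6 , t≡1))) = inj₂ (map₂ inj₁ (exceptional Q m≡6 t≡1))
  from : ∀ P → Listed P → OnCurve 3 (+ 2) (+ 2) P
  from _ (inj₁ refl) = origin-on-curve 3 (+ 2) (+ 2)
  from _ (inj₂ (inj₁ refl)) = refl
  from _ (inj₂ (inj₂ (inj₁ refl))) = refl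
  from _ (inj₂ (inj₂ (inj₂ refl))) = _

theorem1p1 : (p : ℕ) → Prime p →
    ((P : Point) → OnCurve p (+ 0) (+ 2) P ⇔ (P ≡ aff 0ℚ 0ℚ ⊎ P ≡ ∞))
    × (p % 4 ≡ 3 → p ≡ 3 → (P : Point) → OnCurve p (+ 2) (+ 2) P
    ⇔ (P ≡ aff 0ℚ 0ℚ ⊎ P ≡ aff ((+ 6) / 1) ((+ 216) / 1)
    ⊎ P ≡ aff ((+ 6) / 1) ((- (+ 216)) / 1) ⊎ P ≡ ∞))
    × (p % 4 ≡ 3 → p ≢ 3 → (P : Point) → OnCurve p (+ 2) (+ 2) P
    ⇔ (P ≡ aff 0ℚ 0ℚ ⊎ P ≡ ∞))
    × (p % 16 ≡ 13 → (P : Point) → OnCurve p (+ 2) (+ 1) P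
    ⇔ (P ≡ aff 0ℚ 0ℚ ⊎ P ≡ ∞))
    × (p % 16 ≡ 5 → (P : Point) → OnCurve p (+ 2) (+ 3) P
    ⇔ (P ≡ aff 0ℚ 0ℚ ⊎ P ≡ ∞))
theorem1p1 p pp = only-origin p 0 2 (curve₁ pp)
  , (λ { _ refl → exceptional-curve })
  , (λ p%4≡3 p≢3 → only-origin p 2 2 λ m t m⊥t sq → map₂ [ id , (λ (p≡3 , _) → contradiction p≡3 p≢3) ]′ (curve₂ pp p%4≡3 m t m⊥t sq))
  , (λ p%16≡13 → only-origin p 2 1 (curve₃ pp p%16≡13))
  , (λ p%16≡5 → only-origin p 2 3 (curve₄ pp p%16≡5))
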